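{- Let $\pi,\tau\in\mathfrak{S}_m$ be in standard form. If $\pi$ and $\tau$ are strongly c-Wilf equivalent, then $\pi_m-\pi_1=\tau_m-\tau_1$.
   Context: $\mathfrak{S}_n$ is the symmetric group on $[n]$, permutations written $\sigma=\sigma_1\cdots\sigma_n$. The standardization $\operatorname{st}(w)$ of a word of distinct integers replaces its smallest entry by 1, the next smallest by 2, etc. For $\pi\in\mathfrak{S}_m$ and $\sigma\in\mathfrak{S}_n$, $\operatorname{Em}(\pi,\sigma)=\{i\in[n-m+1]:\operatorname{st}(\sigma_i\cdots\sigma_{i+m-1})=\pi\}$. Let $a^\pi_{n,k}$ be the number of $\sigma\in\mathfrak{S}_n$ with $|\operatorname{Em}(\pi,\sigma)|=k$. $\pi$ and $\tau$ are strongly c-Wilf equivalent if $a^\pi_{n,k}=a^\tau_{n,k}$ for all $n,k$. A permutation $\pi\in\mathfrak{S}_m$ is in standard form if $\pi_1<\pi_m$ and $\pi_1+\pi_m\le m+1$. -}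

module Defs where

open import Data.Nat.Base using (ℕ; zero; suc; pred; _+_; _∸_; _<_; _≤_)
import Data.Nat.Properties as ℕ
open import Data.Fin.Base using (Fin; zero; suc; toℕ; fromℕ; punchIn)
open import Data.Fin.Properties using (punchIn-injective)
open import Data.Fin.Permutation as Perm
  using (Permutation′; _⟨$⟩ʳ_; insert; remove; insert-remove)
  renaming (_≈_ to _≈ₚ_)
open import Data.List.Base
  using (List; [_]; map; filter; length; take; drop; upTo; tabulate; allFin; cartesianProductWith)
import Data.List.Properties as List
open import Data.List.Relation.Unary.All using ([])
open import Data.List.Relation.Unary.Any using (here)
open import Data.List.Relation.Unary.AllPairs using ([]; _∷_)
import Data.List.Membership.Setoid as Membership
open import Data.List.Membership.Setoid.Properties using (∈-resp-≈; ∈-cartesianProductWith⁺)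
open import Data.List.Membership.Propositional.Properties using (∈-allFin)
import Data.List.Relation.Unary.Unique.Setoid as Unique
open import Data.List.Relation.Unary.Unique.Setoid.Properties using (cartesianProductWith⁺)
open import Data.List.Relation.Unary.Unique.Propositional.Properties using (allFin⁺)
open import Data.Product.Base using (_×_; _,_)
open import Level using (0ℓ)
open import Relation.Binary.Bundles using (Setoid)
open import Relation.Binary.PropositionalEquality
  using (_≡_; refl; sym; trans; cong₂; setoid)

-- 𝔖ₙ is Permutation′ n, whose positions and entries run over 0, …, n-1.
-- Everything below uses the one-line notation σ₁⋯σₙ with entries in
-- 1, …, n, hence the successor.

entry : ∀ {n} → Permutation′ n → Fin n → ℕ
entry σ i = suc (toℕ (σ ⟨$⟩ʳ i))

first last : ∀ {m} → Permutation′ (suc m) → ℕ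
first     π = entry π zero
last  {m} π = entry π (fromℕ m)

word : ∀ {n} → Permutation′ n → List ℕ
word σ = tabulate (entry σ)

-- On a word of distinct integers the j-th smallest entry x has exactly
-- j entries y ≤ x (itself included), so it is replaced by j.

st : List ℕ → List ℕ
st w = map (λ x → length (filter (λ y → y ℕ.≤? x) w)) w

-- factor w i m = wᵢ ⋯ wᵢ₊ₘ₋₁, for a position i ≥ 1.

factor : List ℕ → ℕ → ℕ → List ℕ
factor w i m = take m (drop (pred i) w)

-- The range is [n-m+1]; suc n ∸ m makes it empty whenever n < m.

Em : ∀ {m n} → Permutation′ m → Permutation′ n → List ℕ
Em {m} {n} π σ =
  filter (λ i → List.≡-dec ℕ._≟_ (st (factor (word σ) i m)) (word π))
         (map suc (upTo (suc n ∸ m)))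

-- An enumeration of 𝔖ₙ: choose σ₁, then the pattern of the rest.
-- permutations-complete and permutations-unique show that, up to
-- pointwise equality, every permutation is listed exactly once.

permutations : ∀ n → List (Permutation′ n)
permutations zero    = [ Perm.id ]
permutations (suc n) = cartesianProductWith (insert zero) (allFin (suc n)) (permutations n)

a : ∀ {m} → Permutation′ m → ℕ → ℕ → ℕ
a π n k = length (filter (λ σ → length (Em π σ) ℕ.≟ k) (permutations n))

StronglyCWilfEquivalent : ∀ {m} → Permutation′ m → Permutation′ m → Set
StronglyCWilfEquivalent π τ = ∀ n k → a π n k ≡ a τ n k

-- Patterns of length suc m, so that π₁ and the last entry exist; the
-- bound "length + 1" is therefore suc m + 1.

StandardForm : ∀ {m} → Permutation′ (suc m) → Set
StandardForm {m} π = first π < last π × first π + last π ≤ suc m + 1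

Permutation-setoid : ℕ → Setoid 0ℓ 0ℓ
Permutation-setoid n = record
  { Carrier       = Permutation′ n
  ; _≈_           = _≈ₚ_
  ; isEquivalence = record
    { refl  = λ _ → refl
    ; sym   = λ p i → sym (p i)
    ; trans = λ p q i → trans (p i) (q i)
    }
  }

private
  insert-cong : ∀ {n} {j j′ : Fin (suc n)} {σ σ′ : Permutation′ n} →
                j ≡ j′ → σ ≈ₚ σ′ → insert zero j σ ≈ₚ insert zero j′ σ′
  insert-cong p q zero    = p
  insert-cong p q (suc i) = cong₂ punchIn p (q i)

  insert-injective : ∀ {n} {j j′ : Fin (suc n)} {σ σ′ : Permutation′ n} →
                     insert zero j σ ≈ₚ insert zero j′ σ′ → j ≡ j′ × σ ≈ₚ σ′
  insert-injective {j = j} p with p zero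
  ... | refl = refl , λ i → punchIn-injective j _ _ (p (suc i))

permutations-complete : ∀ {n} (σ : Permutation′ n) →
  Membership._∈_ (Permutation-setoid n) σ (permutations n)
permutations-complete {zero}  σ = here λ ()
permutations-complete {suc n} σ =
  ∈-resp-≈ (Permutation-setoid (suc n))
    {x = insert zero (σ ⟨$⟩ʳ zero) (remove zero σ)} {y = σ} (insert-remove zero σ)
    (∈-cartesianProductWith⁺ (setoid (Fin (suc n))) (Permutation-setoid n) (Permutation-setoid (suc n))
      (λ {j} {j′} {σ} {σ′} → insert-cong {σ = σ} {σ′})
      (∈-allFin (σ ⟨$⟩ʳ zero)) (permutations-complete (remove zero σ)))

permutations-unique : ∀ n → Unique.Unique (Permutation-setoid n) (permutations n)
permutations-unique zero    = [] ∷ []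
permutations-unique (suc n) =
  cartesianProductWith⁺ (setoid (Fin (suc n))) (Permutation-setoid n) (Permutation-setoid (suc n))
    (insert zero) (λ {j} {j′} {σ} {σ′} → insert-injective {σ = σ} {σ′})
    (allFin⁺ (suc n)) (permutations-unique n)

{-# OPTIONS --safe #-}

-- By the cluster method, the numbers of (permutation, set of k marked
-- occurrences) pairs determine the numbers of k-clusters of length n, i.e. the
-- pairs whose marked occurrences are linked by overlaps and cover 1, …, n.
-- For patterns of length M + 1, a k-cluster of the maximal length n = k M + 1
-- has its occurrences at 1, M + 1, 2M + 1, …, consecutive ones sharing one
-- letter.  Put d = π_{M+1} - π₁ and e = M - d.  The k d + 1 entries of rank
-- between π₁ and π_{M+1} in their block form one increasing chain, so a cluster
-- is determined by its k e other entries and there are at most n^{k e} of them.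
-- Conversely, filling the smallest values, then the chain, then the largest
-- values gives at least (k!)^e clusters.  As k!^e exceeds (k M + 1)^{k e′} for
-- e′ < e and large k, the number e, and hence d, is determined by the cluster
-- numbers.

module Submission where

open import Defs
open import Data.Nat.Base
open import Data.Nat.Properties as ℕₚ
open import Algebra.Properties.CommutativeSemigroup +-commutativeSemigroup using (interchange)
import Data.Integer.Properties as ℤₚ
open import Data.Bool.Base using (true; false; if_then_else_)
open import Data.Empty using (⊥; ⊥-elim)
open import Data.Fin.Base as Fin using (Fin; zero; suc; toℕ; fromℕ<)
import Data.Fin.Properties as Finₚ
open import Algebra.Properties.CommutativeMonoid.Sum +-0-commutativeMonoid using (sum; sum-permute; sum-cong-≗)
open import Data.Fin.Permutation as Perm using (Permutation′; _⟨$⟩ʳ_; _⟨$⟩ˡ_; insert; flip)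
open import Relation.Binary.Bundles using (Setoid)
open import Data.List.Base
  using (List; []; _∷_; _++_; map; filter; length; take; drop; upTo; tabulate; allFin; lookup; cartesianProductWith)
open import Data.Nat.DivMod
open import Data.Nat.Divisibility using (divides)
import Data.List.Properties as Listₚ
import Data.List.Relation.Unary.All.Properties as Allₚ
import Data.List.Relation.Unary.AllPairs.Properties as AllPairsₚ
open import Data.List.Relation.Unary.All as All using (All; []; _∷_)
open import Data.List.Relation.Unary.AllPairs as AllPairs using (AllPairs; []; _∷_)
import Data.List.Relation.Unary.Any as Any
import Data.List.Membership.Setoid as Membership
import Data.List.Membership.Setoid.Properties as Membershipₚ
open import Data.List.Relation.Binary.Sublist.Propositional using (_⊆_; []; _∷ʳ_; _∷_; ⊆-refl)
open import Data.List.Relation.Binary.Sublist.Propositional.Properties using (All-resp-⊆)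
open import Data.Product.Base using (∃₂; ∃-syntax; _×_; _,_; proj₁; proj₂)
open import Data.Sum.Base using (_⊎_; inj₁; inj₂)
open import Data.Unit.Base using (⊤; tt)
open import Function.Base using (_∘_; id; case_of_)
open import Relation.Nullary.Decidable using (_×-dec_)
open import Relation.Binary.Definitions using (tri<; tri≈; tri>)
open import Relation.Nullary using (¬_; Dec; yes; no; does; contradiction)
open import Relation.Binary.PropositionalEquality
  using (_≡_; _≢_; refl; sym; trans; cong; cong₂; subst; subst₂; module ≡-Reasoning)

-- The hypothesis enters through the sums over `i` of `a π n i * binom i k`, which count the pairs
-- of a permutation of length `n` and a set of `k` marked occurrences. Inverting generating
-- functions, with their signs, is avoided: each pair is cut after the cluster that contains its
-- first letter, and in the resulting recurrence the clusters of full length enter with coefficient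
-- 1, so induction on the length and cancellation in ℕ isolate them.
--
-- The two sides of a cut are words on complementary sets of letters rather than permutations.
--
-- The lower bound for one pattern meets the upper bound for the other, which gives e ≤ e′;
-- exchanging the patterns gives equality. Unboundedly many k suffice for this, so k is a power of
-- two, where k^k ≤ 4^k k! follows by doubling. Taking k-th roots then leaves k^e ≤ C k^e′ with C
-- independent of k.

-- Sums over arrangements of letters.

private variable
  A B : Set

-- ∑pick X h sums h x Y over the ways of extracting an entry x from X, leaving Y.

∑pick : List A → (A → List A → ℕ) → ℕ
∑pick []      h = 0
∑pick (x ∷ X) h = h x X + ∑pick X (λ y Y → h y (x ∷ Y))

-- ∑arr j X h sums h u R over the words u made of j entries of X, leaving R.

∑arr : ℕ → List A → (List A → List A → ℕ) → ℕ
∑arr zero    X h = h [] X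
∑arr (suc j) X h = ∑pick X (λ x Y → ∑arr j Y (λ u R → h (x ∷ u) R))

∑pick-cong : ∀ (X : List A) {h h′} →
  (∀ x Y → Y ⊆ X → length X ≡ suc (length Y) → h x Y ≡ h′ x Y) → ∑pick X h ≡ ∑pick X h′
∑pick-cong []      e = refl
∑pick-cong (x ∷ X) e = cong₂ _+_ (e x X (x ∷ʳ ⊆-refl) refl)
  (∑pick-cong X λ y Y s l → e y (x ∷ Y) (refl ∷ s) (cong suc l))

∑pick-cong′ : ∀ (X : List A) {h h′} → (∀ x Y → h x Y ≡ h′ x Y) → ∑pick X h ≡ ∑pick X h′
∑pick-cong′ X e = ∑pick-cong X λ x Y _ _ → e x Y

∑pick-+ : ∀ (X : List A) h h′ → ∑pick X (λ x Y → h x Y + h′ x Y) ≡ ∑pick X h + ∑pick X h′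
∑pick-+ []      h h′ = refl
∑pick-+ (x ∷ X) h h′ =
  trans (cong (h x X + h′ x X +_) (∑pick-+ X _ _)) (interchange (h x X) _ _ _)

∑pick-zero : ∀ (X : List A) → ∑pick X (λ _ _ → 0) ≡ 0
∑pick-zero []      = refl
∑pick-zero (x ∷ X) = ∑pick-zero X

∑pick-*ˡ : ∀ (X : List A) c h → ∑pick X (λ x Y → c * h x Y) ≡ c * ∑pick X h
∑pick-*ˡ []      c h = sym (*-zeroʳ c)
∑pick-*ˡ (x ∷ X) c h =
  trans (cong (c * h x X +_) (∑pick-*ˡ X c _)) (sym (*-distribˡ-+ c _ _))

∑pick-const : ∀ (X : List A) c → ∑pick X (λ _ _ → c) ≡ length X * c
∑pick-const []      c = refl
∑pick-const (x ∷ X) c = cong (c +_) (∑pick-const X c)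

∑pick-map : ∀ (φ : A → B) X h → ∑pick (map φ X) h ≡ ∑pick X (λ x Y → h (φ x) (map φ Y))
∑pick-map φ []      h = refl
∑pick-map φ (x ∷ X) h = cong (h (φ x) (map φ X) +_) (∑pick-map φ X _)

-- The head `z` can be picked first, second or not at all: the first two cases exchange the sums `U`
-- and `V`, the third is the induction.
∑pick-swap : ∀ (X : List A) (g : A → A → List A → ℕ) →
  ∑pick X (λ x Y → ∑pick Y (λ y Z → g x y Z)) ≡ ∑pick X (λ y Y → ∑pick Y (λ x Z → g x y Z))
∑pick-swap []      g = refl
∑pick-swap (z ∷ X) g = begin
  U + ∑pick X (λ x Y → g x z Y + ∑pick Y (λ y Z → g x y (z ∷ Z)))
    ≡⟨ cong (U +_) (∑pick-+ X _ _) ⟩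
  U + (V + ∑pick X (λ x Y → ∑pick Y (λ y Z → g x y (z ∷ Z))))
    ≡⟨ cong (λ t → U + (V + t)) (∑pick-swap X (λ x y Z → g x y (z ∷ Z))) ⟩
  U + (V + W) ≡⟨ sym (+-assoc U V W) ⟩
  U + V + W   ≡⟨ cong (_+ W) (+-comm U V) ⟩
  V + U + W   ≡⟨ +-assoc V U W ⟩
  V + (U + W) ≡⟨ cong (V +_) (sym (∑pick-+ X _ _)) ⟩
  V + ∑pick X (λ y Y → g z y Y + ∑pick Y (λ x Z → g x y (z ∷ Z))) ∎
  where
    open ≡-Reasoning
    U = ∑pick X (λ y Z → g z y Z)
    V = ∑pick X (λ x Y → g x z Y)
    W = ∑pick X (λ y Y → ∑pick Y (λ x Z → g x y (z ∷ Z)))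

⊆-AllPairs : ∀ {R : A → A → Set} {X Y} → Y ⊆ X → AllPairs R X → AllPairs R Y
⊆-AllPairs []         ps       = []
⊆-AllPairs (y ∷ʳ s)   (p ∷ ps) = ⊆-AllPairs s ps
⊆-AllPairs (refl ∷ s) (p ∷ ps) = All-resp-⊆ s p ∷ ⊆-AllPairs s ps

∑arr-cong : ∀ j (X : List A) {R : A → A → Set} {h h′} → AllPairs R X →
  (∀ u Y → AllPairs R Y → length u ≡ j → length X ≡ j + length Y → h u Y ≡ h′ u Y) →
  ∑arr j X h ≡ ∑arr j X h′
∑arr-cong zero    X p e = e [] X p refl refl
∑arr-cong (suc j) X p e = ∑pick-cong X λ x Y s l → ∑arr-cong j Y (⊆-AllPairs s p)
  λ u Z q lu lY → e (x ∷ u) Z q (cong suc lu) (trans l (cong suc lY))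

∑arr-cong′ : ∀ j (X : List A) {h h′} → (∀ u Y → h u Y ≡ h′ u Y) → ∑arr j X h ≡ ∑arr j X h′
∑arr-cong′ zero    X e = e [] X
∑arr-cong′ (suc j) X e = ∑pick-cong′ X λ x Y → ∑arr-cong′ j Y λ u Z → e (x ∷ u) Z

∑arr-+ : ∀ j (X : List A) h h′ → ∑arr j X (λ u R → h u R + h′ u R) ≡ ∑arr j X h + ∑arr j X h′
∑arr-+ zero    X h h′ = refl
∑arr-+ (suc j) X h h′ = trans (∑pick-cong′ X λ x Y → ∑arr-+ j Y _ _) (∑pick-+ X _ _)

∑arr-*ˡ : ∀ j (X : List A) c h → ∑arr j X (λ u R → c * h u R) ≡ c * ∑arr j X h
∑arr-*ˡ zero    X c h = refl
∑arr-*ˡ (suc j) X c h = trans (∑pick-cong′ X λ x Y → ∑arr-*ˡ j Y c _) (∑pick-*ˡ X c _)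

∑arr-*ʳ : ∀ j (X : List A) c h → ∑arr j X (λ u R → h u R * c) ≡ ∑arr j X h * c
∑arr-*ʳ j X c h = trans (∑arr-cong′ j X λ u R → *-comm (h u R) c)
  (trans (∑arr-*ˡ j X c h) (*-comm c _))

∑arr-map : ∀ j (φ : A → B) X h →
  ∑arr j (map φ X) h ≡ ∑arr j X (λ u R → h (map φ u) (map φ R))
∑arr-map zero    φ X h = refl
∑arr-map (suc j) φ X h = trans (∑pick-map φ X _) (∑pick-cong′ X λ x Y → ∑arr-map j φ Y _)

∑arr-pick : ∀ j (X : List A) (h : List A → A → List A → ℕ) →
  ∑arr j X (λ u R → ∑pick R (h u)) ≡ ∑pick X (λ y Y → ∑arr j Y (λ u R → h u y R))
∑arr-pick zero    X h = refl
∑arr-pick (suc j) X h = trans (∑pick-cong′ X λ x Y → ∑arr-pick j Y _) (∑pick-swap X _)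

∑≤ : ℕ → (ℕ → ℕ) → ℕ
∑≤ zero    f = f 0
∑≤ (suc n) f = f 0 + ∑≤ n (f ∘ suc)

∑≤-last : ∀ n f → ∑≤ (suc n) f ≡ ∑≤ n f + f (suc n)
∑≤-last zero    f = refl
∑≤-last (suc n) f = trans (cong (f 0 +_) (∑≤-last n (f ∘ suc))) (sym (+-assoc (f 0) _ _))

∑≤-cong : ∀ n {f g} → (∀ j → j ≤ n → f j ≡ g j) → ∑≤ n f ≡ ∑≤ n g
∑≤-cong zero    e = e 0 z≤n
∑≤-cong (suc n) e = cong₂ _+_ (e 0 z≤n) (∑≤-cong n λ j l → e (suc j) (s≤s l))

∑pick-∑≤ : ∀ (X : List A) n (g : ℕ → A → List A → ℕ) →
  ∑pick X (λ x Y → ∑≤ n (λ j → g j x Y)) ≡ ∑≤ n (λ j → ∑pick X (g j))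
∑pick-∑≤ X zero    g = refl
∑pick-∑≤ X (suc n) g = trans (∑pick-+ X _ _) (cong (∑pick X (g 0) +_) (∑pick-∑≤ X n (g ∘ suc)))

∑split : (List A → List A → ℕ) → List A → ℕ
∑split h []      = h [] []
∑split h (x ∷ w) = h [] (x ∷ w) + ∑split (λ u v → h (x ∷ u) v) w

∑arr-split : ∀ n (X : List A) h →
  ∑arr n X (λ w _ → ∑split h w) ≡
  ∑≤ n (λ j → ∑arr j X (λ u R → ∑arr (n ∸ j) R (λ v _ → h u v)))
∑arr-split zero    X h = refl
∑arr-split (suc n) X h = begin
  ∑pick X (λ x Y → ∑arr n Y (λ w _ → h [] (x ∷ w) + ∑split (λ u v → h (x ∷ u) v) w))
    ≡⟨ ∑pick-cong′ X (λ x Y → ∑arr-+ n Y _ _) ⟩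
  ∑pick X (λ x Y → ∑arr n Y (λ w _ → h [] (x ∷ w)) + ∑arr n Y (λ w _ → ∑split (λ u v → h (x ∷ u) v) w))
    ≡⟨ ∑pick-+ X _ _ ⟩
  H + ∑pick X (λ x Y → ∑arr n Y (λ w _ → ∑split (λ u v → h (x ∷ u) v) w))
    ≡⟨ cong (H +_) (trans (∑pick-cong′ X λ x Y → ∑arr-split n Y _) (∑pick-∑≤ X n _)) ⟩
  H + ∑≤ n (λ j → ∑arr (suc j) X (λ u R → ∑arr (n ∸ j) R (λ v _ → h u v))) ∎
  where
    open ≡-Reasoning
    H = ∑pick X (λ x Y → ∑arr n Y (λ w _ → h [] (x ∷ w)))

-- Order invariance: only the number of available letters matters.

StrictMono : (ℕ → ℕ) → Set
StrictMono φ = ∀ {i j} → i < j → φ i < φ j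

iota : ℕ → List ℕ
iota zero    = []
iota (suc n) = 0 ∷ map suc (iota n)

length-iota : ∀ n → length (iota n) ≡ n
length-iota zero    = refl
length-iota (suc n) = cong suc (trans (Listₚ.length-map suc (iota n)) (length-iota n))

iota-sorted : ∀ n → AllPairs _<_ (iota n)
iota-sorted zero    = []
iota-sorted (suc n) = Allₚ.map⁺ (All.universal (λ _ → s≤s z≤n) (iota n))
  ∷ AllPairsₚ.map⁺ (AllPairs.map s≤s (iota-sorted n))

-- The lower bound `b` strengthens the induction: the map obtained for the tail must stay above the
-- head.
sorted-as-map : ∀ b (X : List ℕ) → All (b ≤_) X → AllPairs _<_ X →
  ∃[ φ ] StrictMono φ × (∀ i → b ≤ φ i) × X ≡ map φ (iota (length X))
sorted-as-map b []      _       _        = b +_ , ℕₚ.+-monoʳ-< b , ℕₚ.m≤m+n b , refl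
sorted-as-map b (x ∷ X) (p ∷ _) (q ∷ qs) with sorted-as-map (suc x) X q qs
... | φ , mono , above , eq = ψ , mono′ , above′ , cong (x ∷_) (trans eq (Listₚ.map-∘ (iota (length X))))
  where
    ψ : ℕ → ℕ
    ψ zero    = x
    ψ (suc i) = φ i
    mono′ : StrictMono ψ
    mono′ {zero}  {suc j} _       = above j
    mono′ {suc i} {suc j} (s≤s l) = mono l
    above′ : ∀ i → b ≤ ψ i
    above′ zero    = p
    above′ (suc i) = ≤-trans p (≤-trans (n≤1+n x) (above i))

Invariant : (List ℕ → ℕ) → Set
Invariant f = ∀ {φ} → StrictMono φ → ∀ w → f (map φ w) ≡ f w

-- For invariant `f` this is the binomial coefficient of `n` over `j` times `#arr f j j`; the next
-- two lemmas express this without division.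
#arr : (List ℕ → ℕ) → ℕ → ℕ → ℕ
#arr f j n = ∑arr j (iota n) (λ u _ → f u)

∑arr-invariant : ∀ {f} → Invariant f → ∀ j {X} → AllPairs _<_ X →
  ∑arr j X (λ u _ → f u) ≡ #arr f j (length X)
∑arr-invariant {f} inv j {X} s with sorted-as-map 0 X (All.universal (λ _ → z≤n) X) s
... | φ , mono , _ , eq = begin
  ∑arr j X (λ u _ → f u) ≡⟨ cong (λ Y → ∑arr j Y (λ u _ → f u)) eq ⟩
  ∑arr j (map φ (iota (length X))) (λ u _ → f u) ≡⟨ ∑arr-map j φ (iota (length X)) _ ⟩
  ∑arr j (iota (length X)) (λ u _ → f (map φ u)) ≡⟨ ∑arr-cong′ j _ (λ u _ → inv mono u) ⟩
  #arr f j (length X) ∎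
  where open ≡-Reasoning

-- Both sides count the pairs of a word u of j letters and a letter not in u.

#arr-step : ∀ {f} → Invariant f → ∀ j i → suc i * #arr f j (suc (j + i)) ≡ suc (j + i) * #arr f j (j + i)
#arr-step {f} inv j i = begin
  suc i * #arr f j n ≡⟨ sym (∑arr-*ˡ j (iota n) (suc i) _) ⟩
  ∑arr j (iota n) (λ u _ → suc i * f u) ≡⟨ ∑arr-cong j (iota n) (iota-sorted n) count ⟩
  ∑arr j (iota n) (λ u R → ∑pick R (λ _ _ → f u)) ≡⟨ ∑arr-pick j (iota n) _ ⟩
  ∑pick (iota n) (λ _ Y → ∑arr j Y (λ u _ → f u)) ≡⟨ ∑pick-cong (iota n) rest ⟩
  ∑pick (iota n) (λ _ _ → #arr f j (j + i)) ≡⟨ ∑pick-const (iota n) _ ⟩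
  length (iota n) * #arr f j (j + i) ≡⟨ cong (_* #arr f j (j + i)) (length-iota n) ⟩
  n * #arr f j (j + i) ∎
  where
    open ≡-Reasoning
    n = suc (j + i)
    count : ∀ u Y → AllPairs _<_ Y → length u ≡ j → length (iota n) ≡ j + length Y →
            suc i * f u ≡ ∑pick Y (λ _ _ → f u)
    count u Y _ _ l = sym (trans (∑pick-const Y (f u)) (cong (_* f u)
      (+-cancelˡ-≡ j _ _ (trans (sym l) (trans (length-iota n) (sym (+-suc j i)))))))
    rest : ∀ y Y → Y ⊆ iota n → length (iota n) ≡ suc (length Y) →
           ∑arr j Y (λ u _ → f u) ≡ #arr f j (j + i)
    rest y Y s l = trans (∑arr-invariant inv j (⊆-AllPairs s (iota-sorted n)))
      (cong (#arr f j) (suc-injective (trans (sym l) (length-iota n))))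

#arr-determined : ∀ {f g} → Invariant f → Invariant g → ∀ j → #arr f j j ≡ #arr g j j →
  ∀ i → #arr f j (j + i) ≡ #arr g j (j + i)
#arr-determined {f} {g} p q j e zero    =
  subst (λ n → #arr f j n ≡ #arr g j n) (sym (+-identityʳ j)) e
#arr-determined {f} {g} p q j e (suc i) =
  subst (λ n → #arr f j n ≡ #arr g j n) (sym (+-suc j i))
    (*-cancelˡ-≡ _ _ (suc i) (trans (#arr-step p j i)
      (trans (cong (suc (j + i) *_) (#arr-determined p q j e i)) (sym (#arr-step q j i)))))

-- The enumeration of permutations as a sum over arrangements.

word₀ : ∀ {n} → Permutation′ n → List ℕ
word₀ σ = tabulate (toℕ ∘ (σ ⟨$⟩ʳ_))

word≡ : ∀ {n} (σ : Permutation′ n) → word σ ≡ map suc (word₀ σ)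
word≡ σ = sym (Listₚ.map-tabulate (toℕ ∘ (σ ⟨$⟩ʳ_)) suc)

∑list : List A → (A → ℕ) → ℕ
∑list []       f = 0
∑list (x ∷ xs) f = f x + ∑list xs f

∑list-cong : ∀ (xs : List A) {f g : A → ℕ} → (∀ x → f x ≡ g x) → ∑list xs f ≡ ∑list xs g
∑list-cong []       e = refl
∑list-cong (x ∷ xs) e = cong₂ _+_ (e x) (∑list-cong xs e)

∑list-map : ∀ (g : A → B) xs f → ∑list (map g xs) f ≡ ∑list xs (f ∘ g)
∑list-map g []       f = refl
∑list-map g (x ∷ xs) f = cong (f (g x) +_) (∑list-map g xs f)

∑list-++ : ∀ (xs ys : List A) f → ∑list (xs ++ ys) f ≡ ∑list xs f + ∑list ys f
∑list-++ []       ys f = refl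
∑list-++ (x ∷ xs) ys f = trans (cong (f x +_) (∑list-++ xs ys f)) (sym (+-assoc (f x) _ _))

∑list-product : ∀ {C : Set} (g : A → B → C) xs ys f →
  ∑list (cartesianProductWith g xs ys) f ≡ ∑list xs (λ x → ∑list ys (λ y → f (g x y)))
∑list-product g []       ys f = refl
∑list-product g (x ∷ xs) ys f = trans (∑list-++ (map (g x) ys) _ f)
  (cong₂ _+_ (∑list-map (g x) ys f) (∑list-product g xs ys f))

up : ℕ → ℕ → ℕ
up zero    y       = suc y
up (suc t) zero    = zero
up (suc t) (suc y) = suc (up t y)

toℕ-punchIn : ∀ {n} (j : Fin (suc n)) i → toℕ (Fin.punchIn j i) ≡ up (toℕ j) (toℕ i)
toℕ-punchIn zero    i       = refl
toℕ-punchIn (suc j) zero    = refl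
toℕ-punchIn (suc j) (suc i) = cong suc (toℕ-punchIn j i)

word₀-insert : ∀ {n} (j : Fin (suc n)) (σ : Permutation′ n) →
  word₀ (insert zero j σ) ≡ toℕ j ∷ map (up (toℕ j)) (word₀ σ)
word₀-insert j σ = cong (toℕ j ∷_)
  (trans (Listₚ.tabulate-cong λ i → toℕ-punchIn j (σ ⟨$⟩ʳ i)) (sym (Listₚ.map-tabulate _ (up (toℕ j)))))

allFin-suc : ∀ n → allFin (suc n) ≡ zero ∷ map suc (allFin n)
allFin-suc n = cong (zero ∷_) (sym (Listₚ.map-tabulate id suc))

-- Once `j` is taken from 0, ..., n, the remaining letters in order are the image of 0, ..., n - 1
-- under `up j`, which is how `insert` relabels the rest of a permutation.
∑pick-iota : ∀ n h →
  ∑pick (iota (suc n)) h ≡ ∑list (allFin (suc n)) (λ j → h (toℕ j) (map (up (toℕ j)) (iota n)))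
∑pick-iota n h = trans (cong (h 0 (map suc (iota n)) +_) (trans (∑pick-map suc (iota n) _) (rest n h)))
  (cong (λ js → ∑list js (λ j → h (toℕ j) (map (up (toℕ j)) (iota n)))) (sym (allFin-suc n)))
  where
    open ≡-Reasoning
    rest : ∀ n h → ∑pick (iota n) (λ y Y → h (suc y) (0 ∷ map suc Y)) ≡
           ∑list (map suc (allFin n)) (λ j → h (toℕ j) (map (up (toℕ j)) (iota n)))
    rest zero    h = refl
    rest (suc n) h = begin
      ∑pick (iota (suc n)) (λ y Y → h (suc y) (0 ∷ map suc Y))
        ≡⟨ ∑pick-iota n (λ y Y → h (suc y) (0 ∷ map suc Y)) ⟩
      ∑list (allFin (suc n)) (λ j → h (suc (toℕ j)) (0 ∷ map suc (map (up (toℕ j)) (iota n))))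
        ≡⟨ ∑list-cong (allFin (suc n)) (λ j → cong (λ Y → h (suc (toℕ j)) (0 ∷ Y))
             (trans (sym (Listₚ.map-∘ (iota n))) (Listₚ.map-∘ (iota n)))) ⟩
      ∑list (allFin (suc n)) (λ j → h (suc (toℕ j)) (map (up (suc (toℕ j))) (iota (suc n))))
        ≡⟨ sym (∑list-map suc (allFin (suc n)) _) ⟩
      _ ∎

∑permutations : ∀ n f → ∑list (permutations n) (f ∘ word₀) ≡ #arr f n n
∑permutations zero    f = +-identityʳ (f [])
∑permutations (suc n) f = begin
  ∑list (permutations (suc n)) (f ∘ word₀)
    ≡⟨ ∑list-product (insert zero) (allFin (suc n)) (permutations n) _ ⟩
  ∑list (allFin (suc n)) (λ j → ∑list (permutations n) (λ σ → f (word₀ (insert zero j σ))))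
    ≡⟨ ∑list-cong (allFin (suc n)) (λ j → ∑list-cong (permutations n) λ σ → cong f (word₀-insert j σ)) ⟩
  ∑list (allFin (suc n)) (λ j → ∑list (permutations n) (λ σ → f (toℕ j ∷ map (up (toℕ j)) (word₀ σ))))
    ≡⟨ ∑list-cong (allFin (suc n)) (λ j → ∑permutations n (λ w → f (toℕ j ∷ map (up (toℕ j)) w))) ⟩
  ∑list (allFin (suc n)) (λ j → ∑arr n (iota n) (λ w _ → f (toℕ j ∷ map (up (toℕ j)) w)))
    ≡⟨ ∑list-cong (allFin (suc n)) (λ j → sym (∑arr-map n (up (toℕ j)) (iota n) _)) ⟩
  ∑list (allFin (suc n)) (λ j → ∑arr n (map (up (toℕ j)) (iota n)) (λ w _ → f (toℕ j ∷ w)))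
    ≡⟨ sym (∑pick-iota n (λ x X → ∑arr n X (λ w _ → f (x ∷ w)))) ⟩
  #arr f (suc n) (suc n) ∎
  where open ≡-Reasoning

-- Sequences indexed by the number of marks, and cuts of words.

-- Sequences are treated as power series in a variable counting marks: `shift` multiplies by the
-- variable, `δ` is the series 1 and `conv` is the Cauchy product.
shift : (ℕ → ℕ) → ℕ → ℕ
shift f zero    = 0
shift f (suc k) = f k

δ : ℕ → ℕ
δ zero    = 1
δ (suc k) = 0

conv : (ℕ → ℕ) → (ℕ → ℕ) → ℕ → ℕ
conv f g zero    = f 0 * g 0
conv f g (suc k) = f 0 * g (suc k) + conv (f ∘ suc) g k

conv-cong : ∀ {f f′ g g′} → (∀ i → f i ≡ f′ i) → (∀ i → g i ≡ g′ i) → ∀ k → conv f g k ≡ conv f′ g′ k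
conv-cong p q zero    = cong₂ _*_ (p 0) (q 0)
conv-cong p q (suc k) = cong₂ _+_ (cong₂ _*_ (p 0) (q (suc k))) (conv-cong (p ∘ suc) q k)

conv-zeroˡ : ∀ {f} g → (∀ i → f i ≡ 0) → ∀ k → conv f g k ≡ 0
conv-zeroˡ g z zero    = cong (_* g 0) (z 0)
conv-zeroˡ g z (suc k) = cong₂ _+_ (cong (_* g (suc k)) (z 0)) (conv-zeroˡ g (z ∘ suc) k)

conv-δˡ : ∀ g k → conv δ g k ≡ g k
conv-δˡ g zero    = *-identityˡ (g 0)
conv-δˡ g (suc k) = trans (cong₂ _+_ (*-identityˡ (g (suc k))) (conv-zeroˡ g (λ _ → refl) k)) (+-identityʳ _)

conv-δʳ : ∀ f k → conv f δ k ≡ f k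
conv-δʳ f zero    = *-identityʳ (f 0)
conv-δʳ f (suc k) = cong₂ _+_ (*-zeroʳ (f 0)) (conv-δʳ (f ∘ suc) k)

conv-+ˡ : ∀ f f′ g k → conv (λ i → f i + f′ i) g k ≡ conv f g k + conv f′ g k
conv-+ˡ f f′ g zero    = *-distribʳ-+ (g 0) (f 0) (f′ 0)
conv-+ˡ f f′ g (suc k) =
  trans (cong₂ _+_ (*-distribʳ-+ (g (suc k)) (f 0) (f′ 0)) (conv-+ˡ (f ∘ suc) (f′ ∘ suc) g k))
        (interchange (f 0 * g (suc k)) _ _ _)

conv-*ˡ : ∀ c f g k → conv (λ i → c * f i) g k ≡ c * conv f g k
conv-*ˡ c f g zero    = *-assoc c (f 0) (g 0)
conv-*ˡ c f g (suc k) =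
  trans (cong₂ _+_ (*-assoc c (f 0) (g (suc k))) (conv-*ˡ c (f ∘ suc) g k)) (sym (*-distribˡ-+ c _ _))

conv-shiftˡ : ∀ f g k → conv (shift f) g k ≡ shift (conv f g) k
conv-shiftˡ f g zero    = refl
conv-shiftˡ f g (suc k) = refl

∑arr-convˡ : ∀ j (X : List A) (F : List A → ℕ → ℕ) G k →
  ∑arr j X (λ u _ → conv (F u) G k) ≡ conv (λ i → ∑arr j X (λ u _ → F u i)) G k
∑arr-convˡ j X F G zero    = ∑arr-*ʳ j X (G 0) _
∑arr-convˡ j X F G (suc k) = trans (∑arr-+ j X _ _)
  (cong₂ _+_ (∑arr-*ʳ j X (G (suc k)) _) (∑arr-convˡ j X (λ u → F u ∘ suc) G k))

∑arr-convʳ : ∀ j (X : List A) F (G : List A → ℕ → ℕ) k →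
  ∑arr j X (λ u _ → conv F (G u) k) ≡ conv F (λ i → ∑arr j X (λ u _ → G u i)) k
∑arr-convʳ j X F G zero    = ∑arr-*ˡ j X (F 0) _
∑arr-convʳ j X F G (suc k) = trans (∑arr-+ j X _ _)
  (cong₂ _+_ (∑arr-*ˡ j X (F 0) _) (∑arr-convʳ j X (F ∘ suc) G k))

∑split-cong : ∀ (w : List A) {h h′} → (∀ u v → u ++ v ≡ w → h u v ≡ h′ u v) → ∑split h w ≡ ∑split h′ w
∑split-cong []      e = e [] [] refl
∑split-cong (x ∷ w) e = cong₂ _+_ (e [] (x ∷ w) refl) (∑split-cong w λ u v p → e (x ∷ u) v (cong (x ∷_) p))

∑split-zero : ∀ (w : List A) {h} → (∀ u v → h u v ≡ 0) → ∑split h w ≡ 0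
∑split-zero []      e = e [] []
∑split-zero (x ∷ w) e = cong₂ _+_ (e [] (x ∷ w)) (∑split-zero w λ u v → e (x ∷ u) v)

∑split-+ : ∀ (w : List A) h h′ → ∑split (λ u v → h u v + h′ u v) w ≡ ∑split h w + ∑split h′ w
∑split-+ []      h h′ = refl
∑split-+ (x ∷ w) h h′ =
  trans (cong (h [] (x ∷ w) + h′ [] (x ∷ w) +_) (∑split-+ w _ _)) (interchange (h [] (x ∷ w)) _ _ _)

∑split-*ˡ : ∀ (w : List A) c h → ∑split (λ u v → c * h u v) w ≡ c * ∑split h w
∑split-*ˡ []      c h = refl
∑split-*ˡ (x ∷ w) c h =
  trans (cong (c * h [] (x ∷ w) +_) (∑split-*ˡ w c _)) (sym (*-distribˡ-+ c _ _))

take-++ : ∀ l (u v : List A) → l ≤ length u → take l (u ++ v) ≡ take l u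
take-++ zero    u       v _       = refl
take-++ (suc l) (x ∷ u) v (s≤s p) = cong (x ∷_) (take-++ l u v p)

-- Occurrences, marked occurrences and clusters.

rank : List ℕ → ℕ → ℕ
rank w x = length (filter (λ y → y ≤? x) w)

rank-map : ∀ {φ} → StrictMono φ → ∀ w x → rank (map φ w) (φ x) ≡ rank w x
rank-map mono []      x = refl
rank-map {φ} mono (y ∷ w) x with y ≤? x
... | yes y≤x = trans (cong length (Listₚ.filter-accept (λ z → z ≤? φ x) φy≤φx))
    (trans (cong suc (rank-map mono w x)) (sym (cong length (Listₚ.filter-accept (λ z → z ≤? x) y≤x))))
  where
    φy≤φx : φ y ≤ φ x
    φy≤φx with m≤n⇒m<n∨m≡n y≤x
    ... | inj₁ y<x  = <⇒≤ (mono y<x)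
    ... | inj₂ refl = ≤-refl
... | no  y≰x = trans (cong length (Listₚ.filter-reject (λ z → z ≤? φ x) (<⇒≱ (mono (≰⇒> y≰x)))))
    (trans (rank-map mono w x) (sym (cong length (Listₚ.filter-reject (λ z → z ≤? x) y≰x))))

st-map : ∀ {φ} → StrictMono φ → ∀ w → st (map φ w) ≡ st w
st-map {φ} mono w = trans (sym (Listₚ.map-∘ w)) (Listₚ.map-cong (rank-map mono w) w)

indicator : ∀ {P : Set} → Dec P → ℕ
indicator P? = if does P? then 1 else 0

length-filter-∑ : ∀ {P : A → Set} (P? : ∀ x → Dec (P x)) xs →
  length (filter P? xs) ≡ ∑list xs (λ x → indicator (P? x))
length-filter-∑ P? []       = refl
length-filter-∑ P? (x ∷ xs) with does (P? x)
... | true  = cong suc (length-filter-∑ P? xs)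
... | false = length-filter-∑ P? xs

-- Pascal's rule for a whole row: row `suc o` is row `o` times one plus the variable.
binom : ℕ → ℕ → ℕ
binom zero    k = δ k
binom (suc o) k = binom o k + shift (binom o) k

module Occurrences {m} (π : Permutation′ (suc m)) where

  Occurs : List ℕ → Set
  Occurs w = st (take (suc m) w) ≡ word π

  occurs? : ∀ w → Dec (Occurs w)
  occurs? w = Listₚ.≡-dec _≟_ (st (take (suc m) w)) (word π)

  ind : List ℕ → ℕ
  ind w = indicator (occurs? w)

  Occurs-length : ∀ w → Occurs w → suc m ≤ length w
  Occurs-length w e = subst (_≤ length w) eq (m⊓n≤n (suc m) (length w))
    where
      eq : suc m ⊓ length w ≡ suc m
      eq = trans (sym (Listₚ.length-take (suc m) w))
        (trans (sym (Listₚ.length-map _ (take (suc m) w))) (trans (cong length e) (Listₚ.length-tabulate (entry π))))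

  ind-short : ∀ w → length w ≤ m → ind w ≡ 0
  ind-short w l with occurs? w
  ... | no  _ = refl
  ... | yes o = contradiction (Occurs-length w o) (<⇒≱ (s≤s l))

  ind-++ : ∀ u v → suc m ≤ length u → ind (u ++ v) ≡ ind u
  ind-++ u v l = cong (λ w → indicator (Listₚ.≡-dec _≟_ (st w) (word π))) (take-++ (suc m) u v l)

  ind-invariant : Invariant ind
  ind-invariant {φ} mono w = cong (λ w → indicator (Listₚ.≡-dec _≟_ w (word π)))
    (trans (cong st (Listₚ.take-map (suc m) w)) (st-map mono (take (suc m) w)))

  occ : List ℕ → ℕ
  occ []      = 0
  occ (x ∷ w) = ind (x ∷ w) + occ w

  occ-short : ∀ w → length w ≤ m → occ w ≡ 0
  occ-short []      l = refl
  occ-short (x ∷ w) l = cong₂ _+_ (ind-short (x ∷ w) l) (occ-short w (≤-trans (n≤1+n _) l))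

  occ-invariant : Invariant occ
  occ-invariant mono []      = refl
  occ-invariant mono (x ∷ w) = cong₂ _+_ (ind-invariant mono (x ∷ w)) (occ-invariant mono w)

  -- `occ` tests every suffix, `Em` only the first `length w ∸ m` starting positions; at the other
  -- positions the suffix is too short for an occurrence.
  occ-∑ : ∀ l w → length w ∸ m ≡ l → ∑list (upTo l) (λ i → ind (drop i w)) ≡ occ w
  occ-∑ zero    w       e = sym (occ-short w (m∸n≡0⇒m≤n e))
  occ-∑ (suc l) []      e = contradiction (trans (sym e) (0∸n≡0 m)) λ ()
  occ-∑ (suc l) (x ∷ w) e = cong (ind (x ∷ w) +_)
    (trans (cong (λ is → ∑list is (λ i → ind (drop i (x ∷ w)))) (sym (Listₚ.map-upTo suc l)))
      (trans (∑list-map suc (upTo l) _)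
        (occ-∑ l w (trans (sym (pred[m∸n]≡m∸[1+n] (suc (length w)) m)) (cong pred e)))))

  length-Em : ∀ {n} (σ : Permutation′ n) → length (Em π σ) ≡ occ (word₀ σ)
  length-Em {n} σ = begin
    length (Em π σ) ≡⟨ length-filter-∑ _ (map suc (upTo (suc n ∸ suc m))) ⟩
    ∑list (map suc (upTo (n ∸ m))) (λ i → ind (drop (pred i) (word σ))) ≡⟨ ∑list-map suc (upTo (n ∸ m)) _ ⟩
    ∑list (upTo (n ∸ m)) (λ i → ind (drop i (word σ)))
      ≡⟨ occ-∑ (n ∸ m) (word σ) (cong (_∸ m) (Listₚ.length-tabulate (entry σ))) ⟩
    occ (word σ) ≡⟨ cong occ (word≡ σ) ⟩
    occ (map suc (word₀ σ)) ≡⟨ occ-invariant s≤s (word₀ σ) ⟩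
    occ (word₀ σ) ∎
    where open ≡-Reasoning

  -- marked w k is the number of sets of k occurrences in w.

  marked : List ℕ → ℕ → ℕ
  marked []      k = δ k
  marked (x ∷ w) k = marked w k + ind (x ∷ w) * shift (marked w) k

  marked-binom : ∀ w k → marked w k ≡ binom (occ w) k
  marked-binom []      k = refl
  marked-binom (x ∷ w) k with does (occurs? (x ∷ w))
  ... | false = trans (+-identityʳ _) (marked-binom w k)
  ... | true  = cong₂ _+_ (marked-binom w k) (trans (+-identityʳ _) (shifted k))
    where
      shifted : ∀ k → shift (marked w) k ≡ shift (binom (occ w)) k
      shifted zero    = refl
      shifted (suc k) = marked-binom w k

  marked-invariant : ∀ k → Invariant (λ w → marked w k)
  marked-invariant k       mono []      = refl
  marked-invariant zero    {φ} mono (x ∷ w) = cong₂ _+_ (marked-invariant 0 mono w)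
    (trans (*-zeroʳ (ind (map φ (x ∷ w)))) (sym (*-zeroʳ (ind (x ∷ w)))))
  marked-invariant (suc k) mono (x ∷ w) = cong₂ _+_ (marked-invariant (suc k) mono w)
    (cong₂ _*_ (ind-invariant mono (x ∷ w)) (marked-invariant k mono w))

  -- cluster c w k counts the sets of k occurrences in w that, when the first
  -- c letters of w are already covered by earlier marked occurrences, extend
  -- them to a cluster ending exactly at the end of w.  The clusters of w are
  -- thus counted by c = 1 (a single letter being a cluster with no mark).

  cluster : ℕ → List ℕ → ℕ → ℕ
  cluster zero    []      k = δ k
  cluster zero    (x ∷ w) k = 0
  cluster (suc c) []      k = 0
  cluster (suc c) (x ∷ w) k = cluster c w k + ind (x ∷ w) * shift (cluster m w) k

  cluster-invariant : ∀ c k → Invariant (λ w → cluster c w k)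
  cluster-invariant zero    k       mono []      = refl
  cluster-invariant zero    k       mono (x ∷ w) = refl
  cluster-invariant (suc c) k       mono []      = refl
  cluster-invariant (suc c) zero    {φ} mono (x ∷ w) = cong₂ _+_ (cluster-invariant c 0 mono w)
    (trans (*-zeroʳ (ind (map φ (x ∷ w)))) (sym (*-zeroʳ (ind (x ∷ w)))))
  cluster-invariant (suc c) (suc k) mono (x ∷ w) = cong₂ _+_ (cluster-invariant c (suc k) mono w)
    (cong₂ _*_ (ind-invariant mono (x ∷ w)) (cluster-invariant m k mono w))

  cluster-short : ∀ c w k → c ≤ suc m → length w < c → cluster c w k ≡ 0
  cluster-short (suc c) []      k       _       _       = refl
  cluster-short (suc c) (x ∷ w) k       (s≤s p) (s≤s q) =
    cong₂ _+_ (cluster-short c w k (≤-trans p (n≤1+n m)) q)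
      (cong (_* shift (cluster m w) k) (ind-short (x ∷ w) (≤-trans q p)))

  -- For a given set of marks, the letters covered from the left without a gap, starting with `c`
  -- covered ones, form a unique prefix `u`; the marks in the rest `v` are arbitrary. The induction
  -- reads one letter: unmarked, it uses up one covered letter; marked, it leaves `m` covered
  -- letters after it.
  marked-split : ∀ c w k → c ≤ length w →
    marked w k ≡ ∑split (λ u v → conv (cluster c u) (marked v) k) w
  marked-split zero    []      k _ = sym (conv-δˡ (marked []) k)
  marked-split zero    (x ∷ w) k _ = sym (trans
    (cong₂ _+_ (conv-δˡ (marked (x ∷ w)) k) (∑split-zero w λ u v → conv-zeroˡ (marked v) (λ _ → refl) k))
    (+-identityʳ _))
  marked-split (suc c) (x ∷ w) k (s≤s c≤w) = sym (begin
    conv (λ _ → 0) (marked (x ∷ w)) k + ∑split (λ u v → conv (cluster (suc c) (x ∷ u)) (marked v) k) w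
      ≡⟨ cong (_+ ∑split (λ u v → conv (cluster (suc c) (x ∷ u)) (marked v) k) w) (conv-zeroˡ (marked (x ∷ w)) (λ _ → refl) k) ⟩
    ∑split (λ u v → conv (cluster (suc c) (x ∷ u)) (marked v) k) w
      ≡⟨ ∑split-cong w expand ⟩
    ∑split (λ u v → conv (cluster c u) (marked v) k
                    + ind (x ∷ w) * shift (conv (cluster m u) (marked v)) k) w
      ≡⟨ ∑split-+ w _ _ ⟩
    ∑split (λ u v → conv (cluster c u) (marked v) k) w
      + ∑split (λ u v → ind (x ∷ w) * shift (conv (cluster m u) (marked v)) k) w
      ≡⟨ cong₂ _+_ (sym (marked-split c w k c≤w)) (∑split-*ˡ w (ind (x ∷ w)) _) ⟩
    marked w k + ind (x ∷ w) * ∑split (λ u v → shift (conv (cluster m u) (marked v)) k) w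
      ≡⟨ cong (marked w k +_) (recurse k) ⟩
    marked w k + ind (x ∷ w) * shift (marked w) k ∎)
    where
      open ≡-Reasoning
      -- The cluster sees only `x ∷ u`, while the mark refers to `x ∷ w`. An occurrence fits into
      -- `x ∷ u` when `u` has at least `m` letters; for shorter `u` the factor `cluster m u` makes
      -- both sides zero.
      move : ∀ u v → u ++ v ≡ w → ind (x ∷ u) * shift (conv (cluster m u) (marked v)) k
             ≡ ind (x ∷ w) * shift (conv (cluster m u) (marked v)) k
      move u v e with m ≤? length u
      ... | yes l = cong (_* shift (conv (cluster m u) (marked v)) k)
              (sym (trans (cong (λ w → ind (x ∷ w)) (sym e)) (ind-++ (x ∷ u) v (s≤s l))))
      ... | no  l = trans (vanish (ind (x ∷ u)) k) (sym (vanish (ind (x ∷ w)) k))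
        where
          vanish : ∀ i k → i * shift (conv (cluster m u) (marked v)) k ≡ 0
          vanish i zero    = *-zeroʳ i
          vanish i (suc k) = trans (cong (i *_) (conv-zeroˡ (marked v)
            (λ j → cluster-short m u j (n≤1+n m) (≰⇒> l)) k)) (*-zeroʳ i)
      expand : ∀ u v → u ++ v ≡ w → conv (cluster (suc c) (x ∷ u)) (marked v) k
               ≡ conv (cluster c u) (marked v) k + ind (x ∷ w) * shift (conv (cluster m u) (marked v)) k
      expand u v e = begin
        conv (cluster (suc c) (x ∷ u)) (marked v) k
          ≡⟨ conv-+ˡ (cluster c u) (λ i → ind (x ∷ u) * shift (cluster m u) i) (marked v) k ⟩
        conv (cluster c u) (marked v) k + conv (λ i → ind (x ∷ u) * shift (cluster m u) i) (marked v) k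
          ≡⟨ cong (conv (cluster c u) (marked v) k +_)
               (trans (conv-*ˡ (ind (x ∷ u)) (shift (cluster m u)) (marked v) k)
                 (cong (ind (x ∷ u) *_) (conv-shiftˡ (cluster m u) (marked v) k))) ⟩
        conv (cluster c u) (marked v) k + ind (x ∷ u) * shift (conv (cluster m u) (marked v)) k
          ≡⟨ cong (conv (cluster c u) (marked v) k +_) (move u v e) ⟩
        conv (cluster c u) (marked v) k + ind (x ∷ w) * shift (conv (cluster m u) (marked v)) k ∎
      -- The induction needs `m` letters in `w`; with fewer there is no room for an occurrence and
      -- the coefficient `ind (x ∷ w)` is zero.
      recurse : ∀ k → ind (x ∷ w) * ∑split (λ u v → shift (conv (cluster m u) (marked v)) k) w
                ≡ ind (x ∷ w) * shift (marked w) k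
      recurse zero    = cong (ind (x ∷ w) *_) (∑split-zero w λ _ _ → refl)
      recurse (suc k) with m ≤? length w
      ... | yes l = cong (ind (x ∷ w) *_) (sym (marked-split m w k l))
      ... | no  l = trans (cong (_* ∑split (λ u v → conv (cluster m u) (marked v) k) w) z)
                          (sym (cong (_* marked w k) z))
        where
          z : ind (x ∷ w) ≡ 0
          z = ind-short (x ∷ w) (≰⇒> l)

  total : ℕ → ℕ → ℕ
  total n k = #arr (λ w → marked w k) n n

  clusters : ℕ → ℕ → ℕ
  clusters n k = #arr (λ w → cluster 1 w k) n n

  -- Cutting after the cluster of the first letter, which is a single letter if no mark covers it.
  -- The case where this cluster is the whole word is split off, to be solved for.
  total-recurrence : ∀ n k → total (suc n) k ≡
    ∑≤ n (λ j → conv (λ i → #arr (λ w → cluster 1 w i) j (suc n)) (total (suc n ∸ j)) k) + clusters (suc n) k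
  total-recurrence n k = begin
    total (suc n) k
      ≡⟨ ∑arr-cong (suc n) (iota (suc n)) (iota-sorted (suc n)) (λ u Y _ l _ →
           marked-split 1 u k (subst (1 ≤_) (sym l) (s≤s z≤n))) ⟩
    ∑arr (suc n) (iota (suc n)) (λ w _ → ∑split (λ u v → conv (cluster 1 u) (marked v) k) w)
      ≡⟨ ∑arr-split (suc n) (iota (suc n)) (λ u v → conv (cluster 1 u) (marked v) k) ⟩
    ∑≤ (suc n) (λ j → ∑arr j (iota (suc n)) (λ u R → ∑arr (suc n ∸ j) R (λ v _ → conv (cluster 1 u) (marked v) k)))
      ≡⟨ ∑≤-cong (suc n) term ⟩
    ∑≤ (suc n) (λ j → conv (λ i → #arr (λ w → cluster 1 w i) j (suc n)) (total (suc n ∸ j)) k)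
      ≡⟨ ∑≤-last n _ ⟩
    ∑≤ n (λ j → conv (λ i → #arr (λ w → cluster 1 w i) j (suc n)) (total (suc n ∸ j)) k)
      + conv (clusters (suc n)) (total (suc n ∸ suc n)) k
      -- At `j = suc n` no letter is left, and `total 0` is `δ`, the unit of `conv`.
      ≡⟨ cong (∑≤ n (λ j → conv (λ i → #arr (λ w → cluster 1 w i) j (suc n)) (total (suc n ∸ j)) k) +_)
           (trans (conv-cong (λ _ → refl) (λ i → cong (λ l → total l i) (n∸n≡0 n)) k) (conv-δʳ _ k)) ⟩
    _ ∎
    where
      open ≡-Reasoning
      term : ∀ j → j ≤ suc n →
        ∑arr j (iota (suc n)) (λ u R → ∑arr (suc n ∸ j) R (λ v _ → conv (cluster 1 u) (marked v) k))
        ≡ conv (λ i → #arr (λ w → cluster 1 w i) j (suc n)) (total (suc n ∸ j)) k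
      term j _ = trans (∑arr-cong j (iota (suc n)) (iota-sorted (suc n)) inner)
        (∑arr-convˡ j (iota (suc n)) (cluster 1) (total (suc n ∸ j)) k)
        where
          inner : ∀ u R → AllPairs _<_ R → length u ≡ j → length (iota (suc n)) ≡ j + length R →
            ∑arr (suc n ∸ j) R (λ v _ → conv (cluster 1 u) (marked v) k)
            ≡ conv (cluster 1 u) (total (suc n ∸ j)) k
          inner u R s _ l = trans (∑arr-convʳ (suc n ∸ j) R (cluster 1 u) marked k)
            (conv-cong (λ _ → refl) (λ i → trans (∑arr-invariant (marked-invariant i) (suc n ∸ j) s)
              (cong (#arr (λ w → marked w i) (suc n ∸ j)) lR)) k)
            where
              lR : length R ≡ suc n ∸ j
              lR = sym (trans (cong (_∸ j) (trans (sym (length-iota (suc n))) l)) (m+n∸m≡n j (length R)))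

-- Strong c-Wilf equivalence determines the cluster numbers.

∑list-*ʳ : ∀ (xs : List A) f c → ∑list xs (λ x → f x * c) ≡ ∑list xs f * c
∑list-*ʳ []       f c = refl
∑list-*ʳ (x ∷ xs) f c = trans (cong (f x * c +_) (∑list-*ʳ xs f c)) (sym (*-distribʳ-+ c (f x) _))

∑list-+ : ∀ (xs : List A) f g → ∑list xs (λ x → f x + g x) ≡ ∑list xs f + ∑list xs g
∑list-+ []       f g = refl
∑list-+ (x ∷ xs) f g = trans (cong (f x + g x +_) (∑list-+ xs f g)) (interchange (f x) _ _ _)

∑list-∑≤ : ∀ (xs : List A) b (g : ℕ → A → ℕ) →
  ∑list xs (λ x → ∑≤ b (λ k → g k x)) ≡ ∑≤ b (λ k → ∑list xs (g k))
∑list-∑≤ xs zero    g = refl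
∑list-∑≤ xs (suc b) g = trans (∑list-+ xs (g 0) _) (cong (∑list xs (g 0) +_) (∑list-∑≤ xs b (g ∘ suc)))

∑≤-zero : ∀ b f → (∀ k → f k ≡ 0) → ∑≤ b f ≡ 0
∑≤-zero zero    f z = z 0
∑≤-zero (suc b) f z = cong₂ _+_ (z 0) (∑≤-zero b (f ∘ suc) (z ∘ suc))

∑≤-indicator : ∀ b v (F : ℕ → ℕ) → v ≤ b → ∑≤ b (λ k → indicator (v ≟ k) * F k) ≡ F v
∑≤-indicator zero    zero    F _       = +-identityʳ (F 0)
∑≤-indicator (suc b) zero    F _       =
  trans (cong₂ _+_ (+-identityʳ (F 0)) (∑≤-zero b _ λ _ → refl)) (+-identityʳ (F 0))
∑≤-indicator (suc b) (suc v) F (s≤s l) = ∑≤-indicator b v (F ∘ suc) l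

∑list-by-value : ∀ (xs : List A) b N (F : ℕ → ℕ) → (∀ x → N x ≤ b) →
  ∑list xs (F ∘ N) ≡ ∑≤ b (λ k → length (filter (λ x → N x ≟ k) xs) * F k)
∑list-by-value xs b N F N≤b = begin
  ∑list xs (F ∘ N) ≡⟨ ∑list-cong xs (λ x → sym (∑≤-indicator b (N x) F (N≤b x))) ⟩
  ∑list xs (λ x → ∑≤ b (λ k → indicator (N x ≟ k) * F k)) ≡⟨ ∑list-∑≤ xs b _ ⟩
  ∑≤ b (λ k → ∑list xs (λ x → indicator (N x ≟ k) * F k))
    ≡⟨ ∑≤-cong b (λ k _ → trans (∑list-*ʳ xs _ (F k))
         (cong (_* F k) (sym (length-filter-∑ (λ x → N x ≟ k) xs)))) ⟩
  ∑≤ b (λ k → length (filter (λ x → N x ≟ k) xs) * F k) ∎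
  where open ≡-Reasoning

module _ {m} (π : Permutation′ (suc m)) where
  open Occurrences π

  length-Em-≤ : ∀ {n} (σ : Permutation′ n) → length (Em π σ) ≤ n ∸ m
  length-Em-≤ {n} σ = subst (length (Em π σ) ≤_)
    (trans (Listₚ.length-map suc (upTo (n ∸ m))) (Listₚ.length-upTo (n ∸ m)))
    (Listₚ.length-filter (λ i → Listₚ.≡-dec _≟_ (st (factor (word σ) i (suc m))) (word π)) (map suc (upTo (n ∸ m))))

  -- Permutations are grouped by their number `i` of occurrences; each contributes one marked pair
  -- for every choice of `k` of them.
  total-from-a : ∀ n k → total n k ≡ ∑≤ (n ∸ m) (λ i → a π n i * binom i k)
  total-from-a n k = begin
    total n k ≡⟨ sym (∑permutations n (λ w → marked w k)) ⟩
    ∑list (permutations n) (λ σ → marked (word₀ σ) k)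
      ≡⟨ ∑list-cong (permutations n) (λ σ → trans (marked-binom (word₀ σ) k)
           (cong (λ o → binom o k) (sym (length-Em σ)))) ⟩
    ∑list (permutations n) (λ σ → binom (length (Em π σ)) k)
      ≡⟨ ∑list-by-value (permutations n) (n ∸ m) (λ σ → length (Em π σ)) (λ i → binom i k) length-Em-≤ ⟩
    ∑≤ (n ∸ m) (λ i → a π n i * binom i k) ∎
    where open ≡-Reasoning

module _ {m} (π τ : Permutation′ (suc m)) (π~τ : StronglyCWilfEquivalent π τ) where
  private
    module P = Occurrences π
    module T = Occurrences τ

  total-equal : ∀ n k → P.total n k ≡ T.total n k
  total-equal n k = trans (total-from-a π n k)
    (trans (∑≤-cong (n ∸ m) λ i _ → cong (_* binom i k) (π~τ n i)) (sym (total-from-a τ n k)))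

  -- Strong induction on the length. The terms with a first cluster on `j ≤ n` of the `suc n`
  -- letters agree by induction and `#arr-determined`; cancelling them leaves the clusters of full
  -- length.
  clusters-equal : ∀ n k → P.clusters n k ≡ T.clusters n k
  clusters-equal n = upto n n ≤-refl
    where
      upto : ∀ N n → n ≤ N → ∀ k → P.clusters n k ≡ T.clusters n k
      upto N       zero    _       k = refl
      upto (suc N) (suc n) (s≤s l) k = +-cancelˡ-≡
        (∑≤ n (λ j → conv (λ i → #arr (λ w → T.cluster 1 w i) j (suc n)) (T.total (suc n ∸ j)) k)) _ _
        (trans (cong (_+ P.clusters (suc n) k) (∑≤-cong n λ j j≤n → conv-cong
            (λ i → sym (smaller j j≤n i)) (λ i → sym (total-equal (suc n ∸ j) i)) k))
          (trans (sym (P.total-recurrence n k)) (trans (total-equal (suc n) k) (T.total-recurrence n k))))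
        where
          smaller : ∀ j → j ≤ n → ∀ i →
            #arr (λ w → P.cluster 1 w i) j (suc n) ≡ #arr (λ w → T.cluster 1 w i) j (suc n)
          smaller j j≤n i = subst
            (λ N → #arr (λ w → P.cluster 1 w i) j N ≡ #arr (λ w → T.cluster 1 w i) j N)
            (m+[n∸m]≡n (≤-trans j≤n (n≤1+n n)))
            (#arr-determined (P.cluster-invariant 1 i) (T.cluster-invariant 1 i) j
              (upto N j (≤-trans j≤n l) i) (suc n ∸ j))

-- Positions are 0-based; the value past the end of the word is junk.

at : List ℕ → ℕ → ℕ
at []      p       = 0
at (x ∷ w) zero    = x
at (x ∷ w) (suc p) = at w p

at-drop : ∀ l w p → at (drop l w) p ≡ at w (l + p)
at-drop zero    w       p = refl
at-drop (suc l) []      p = refl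
at-drop (suc l) (x ∷ w) p = at-drop l w p

at-take : ∀ l w p → p < l → at (take l w) p ≡ at w p
at-take (suc l) []      p       _       = refl
at-take (suc l) (x ∷ w) zero    _       = refl
at-take (suc l) (x ∷ w) (suc p) (s≤s q) = at-take l w p q

at-map : ∀ φ w p → p < length w → at (map φ w) p ≡ φ (at w p)
at-map φ (x ∷ w) zero    _       = refl
at-map φ (x ∷ w) (suc p) (s≤s q) = at-map φ w p q

at-tabulate : ∀ {n} (f : Fin n → ℕ) i → at (tabulate f) (toℕ i) ≡ f i
at-tabulate f zero    = refl
at-tabulate f (suc i) = at-tabulate (f ∘ suc) i

at-ext : ∀ u w → length u ≡ length w → (∀ p → p < length w → at u p ≡ at w p) → u ≡ w
at-ext []      []      _ _ = refl
at-ext (x ∷ u) (y ∷ w) l e = cong₂ _∷_ (e 0 (s≤s z≤n)) (at-ext u w (suc-injective l) λ p q → e (suc p) (s≤s q))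

rank-mono : ∀ w {x y} → x ≤ y → rank w x ≤ rank w y
rank-mono []      x≤y = z≤n
rank-mono (z ∷ w) {x} {y} x≤y with z ≤? x
... | yes z≤x = subst₂ _≤_ (sym (cong length (Listₚ.filter-accept (λ t → t ≤? x) z≤x)))
                  (sym (cong length (Listₚ.filter-accept (λ t → t ≤? y) (≤-trans z≤x x≤y)))) (s≤s (rank-mono w x≤y))
... | no  z≰x = ≤-trans (≤-reflexive (cong length (Listₚ.filter-reject (λ t → t ≤? x) z≰x)))
                  (≤-trans (rank-mono w x≤y) (suffix (z ≤? y)))
  where
    suffix : Dec (z ≤ y) → rank w y ≤ rank (z ∷ w) y
    suffix (yes z≤y) = ≤-trans (n≤1+n _) (≤-reflexive (sym (cong length (Listₚ.filter-accept (λ t → t ≤? y) z≤y))))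
    suffix (no  z≰y) = ≤-reflexive (sym (cong length (Listₚ.filter-reject (λ t → t ≤? y) z≰y)))

sum-≤ : ∀ n x → x < n → sum {n} (λ i → indicator (toℕ i ≤? x)) ≡ suc x
sum-≤ (suc n) zero    _       = cong suc (none n)
  where
    none : ∀ n → sum {n} (λ _ → 0) ≡ 0
    none zero    = refl
    none (suc n) = none n
sum-≤ (suc n) (suc x) (s≤s l) = cong suc (trans (sum-cong-≗ {n} λ i → pred-≤ (toℕ i) x) (sum-≤ n x l))
  where
    pred-≤ : ∀ y x → indicator (suc y ≤? suc x) ≡ indicator (y ≤? x)
    pred-≤ zero    x = refl
    pred-≤ (suc y) x = refl

length-filter-tabulate : ∀ {n} {P : ℕ → Set} (P? : ∀ x → Dec (P x)) (f : Fin n → ℕ) →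
  length (filter P? (tabulate f)) ≡ sum (λ i → indicator (P? (f i)))
length-filter-tabulate {zero}  P? f = refl
length-filter-tabulate {suc n} P? f with does (P? (f zero))
... | true  = cong suc (length-filter-tabulate P? (f ∘ suc))
... | false = length-filter-tabulate P? (f ∘ suc)

-- Reindexing the sum of indicators along `σ` turns a count of entries into a count of the numbers
-- up to `x`.
rank-word₀ : ∀ {n} (σ : Permutation′ n) x → x < n → rank (word₀ σ) x ≡ suc x
rank-word₀ {n} σ x l = trans (length-filter-tabulate (λ y → y ≤? x) (toℕ ∘ (σ ⟨$⟩ʳ_)))
  (trans (sym (sum-permute (λ i → indicator (toℕ i ≤? x)) σ)) (sum-≤ n x l))

st-word₀ : ∀ {n} (σ : Permutation′ n) → st (word₀ σ) ≡ word σ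
st-word₀ σ = trans (Listₚ.map-tabulate (toℕ ∘ (σ ⟨$⟩ʳ_)) (rank (word₀ σ)))
  (Listₚ.tabulate-cong λ i → rank-word₀ σ (toℕ (σ ⟨$⟩ʳ i)) (Finₚ.toℕ<n (σ ⟨$⟩ʳ i)))

at-word₀ : ∀ {n} (σ : Permutation′ n) i → at (word₀ σ) (toℕ i) ≡ toℕ (σ ⟨$⟩ʳ i)
at-word₀ σ = at-tabulate (toℕ ∘ (σ ⟨$⟩ʳ_))

length-word₀ : ∀ {n} (σ : Permutation′ n) → length (word₀ σ) ≡ n
length-word₀ σ = Listₚ.length-tabulate (toℕ ∘ (σ ⟨$⟩ʳ_))

module _ {m} (π : Permutation′ (suc m)) where
  open Occurrences π

  -- Ranks within a factor depend monotonically on the letters, so letters in the wrong weak order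
  -- would have ranks in the wrong order.
  Occurs⇒order : ∀ w → Occurs w → ∀ {p q} → p ≤ m → q ≤ m →
    at (word₀ π) p < at (word₀ π) q → at w p < at w q
  Occurs⇒order w o {p} {q} p≤m q≤m l = ≰⇒> λ le → <⇒≱ (s≤s l)
    (subst₂ _≤_ (rank-at q q≤m) (rank-at p p≤m) (rank-mono v le))
    where
      v = take (suc m) w
      length-v : length v ≡ suc m
      length-v = trans (Listₚ.length-take (suc m) w) (m≤n⇒m⊓n≡m (Occurs-length w o))
      rank-at : ∀ p → p ≤ m → rank v (at w p) ≡ suc (at (word₀ π) p)
      rank-at p l = begin
        rank v (at w p) ≡⟨ cong (rank v) (sym (at-take (suc m) w p (s≤s l))) ⟩
        rank v (at v p) ≡⟨ sym (at-map (rank v) v p (subst (p <_) (sym length-v) (s≤s l))) ⟩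
        at (st v) p     ≡⟨ cong (λ u → at u p) (trans o (word≡ π)) ⟩
        at (map suc (word₀ π)) p ≡⟨ at-map suc (word₀ π) p (subst (p <_) (sym (length-word₀ π)) (s≤s l)) ⟩
        suc (at (word₀ π) p) ∎
        where open ≡-Reasoning

  order⇒Occurs : ∀ {φ} → StrictMono φ → ∀ w → suc m ≤ length w →
    (∀ p → p ≤ m → at w p ≡ φ (at (word₀ π) p)) → Occurs w
  order⇒Occurs {φ} mono w l e = trans (cong st as-map) (trans (st-map mono (word₀ π)) (st-word₀ π))
    where
      as-map : take (suc m) w ≡ map φ (word₀ π)
      as-map = at-ext _ _
        (trans (Listₚ.length-take (suc m) w) (trans (m≤n⇒m⊓n≡m l)
          (sym (trans (Listₚ.length-map φ (word₀ π)) (length-word₀ π)))))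
        λ p q → let q′ = subst (p <_) (Listₚ.length-map φ (word₀ π)) q
                    q″ = subst (p <_) (length-word₀ π) q′ in
          trans (at-take (suc m) w p q″) (trans (e p (s≤s⁻¹ q″)) (sym (at-map φ (word₀ π) p q′)))

-- Clusters of maximal length.

module Chain {m} (π : Permutation′ (suc (suc m))) where
  open Occurrences π
  private M = suc m

  Good : ℕ → List ℕ → Set
  Good zero    w = ⊤
  Good (suc k) w = Occurs w × Good k (drop M w)

  good? : ∀ k w → Dec (Good k w)
  good? zero    w = yes tt
  good? (suc k) w = occurs? w ×-dec good? k (drop M w)

  cluster-long : ∀ c w k → c + k * M < length w → cluster c w k ≡ 0
  cluster-long zero    (x ∷ w) k       _       = refl
  cluster-long (suc c) (x ∷ w) zero    (s≤s l) = cong₂ _+_ (cluster-long c w 0 l) (*-zeroʳ (ind (x ∷ w)))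
  cluster-long (suc c) (x ∷ w) (suc k) (s≤s l) = cong₂ _+_ (cluster-long c w (suc k) l)
    (trans (cong (ind (x ∷ w) *_) (cluster-long M w k (≤-<-trans (m≤n+m (M + k * M) c) l))) (*-zeroʳ (ind (x ∷ w))))

  -- The length is the largest that `k` marks can reach from `suc c` covered letters. A mark before
  -- the last covered letter wastes some of this reach, so `cluster-long` excludes it.
  cluster-advance : ∀ c w k → length w ≡ suc (c + k * M) → cluster (suc c) w k ≡ cluster 1 (drop c w) k
  cluster-advance zero    w       k _ = refl
  cluster-advance (suc c) (x ∷ w) k e = trans (cong₂ _+_ (cluster-advance c w k (suc-injective e)) (no-mark k e))
                                              (+-identityʳ _)
    where
      no-mark : ∀ k → length (x ∷ w) ≡ suc (suc (c + k * M)) → ind (x ∷ w) * shift (cluster M w) k ≡ 0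
      no-mark zero    e = *-zeroʳ (ind (x ∷ w))
      no-mark (suc k) e = trans (cong (ind (x ∷ w) *_) (cluster-long M w k
        (subst (M + k * M <_) (sym (suc-injective e)) (s≤s (m≤n+m (M + k * M) c))))) (*-zeroʳ (ind (x ∷ w)))

  indicator-× : ∀ {P Q : Set} (P? : Dec P) (Q? : Dec Q) → indicator (P? ×-dec Q?) ≡ indicator P? * indicator Q?
  indicator-× P? Q? with does P?
  ... | true  = sym (+-identityʳ _)
  ... | false = refl

  -- In a word of the maximal length k M + 1, consecutive occurrences of a
  -- cluster overlap in exactly one letter.

  cluster-maximal : ∀ k w → length w ≡ suc (k * M) → cluster 1 w k ≡ indicator (good? k w)
  cluster-maximal zero    (x ∷ []) e = cong suc (*-zeroʳ (ind (x ∷ [])))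
  cluster-maximal (suc k) (x ∷ y ∷ w) e = trans
    (cong (ind (x ∷ y ∷ w) *_) (trans (cluster-advance m (y ∷ w) k (suc-injective e))
      (cluster-maximal k (drop m (y ∷ w)) (trans (Listₚ.length-drop m (y ∷ w))
        (trans (cong (_∸ m) (trans (suc-injective e) (sym (+-suc m (k * M))))) (m+n∸m≡n m _))))))
    (sym (indicator-× (occurs? (x ∷ y ∷ w)) (good? k (drop m (y ∷ w)))))

  clusters-maximal : ∀ k → clusters (suc (k * M)) k ≡
    length (filter (λ σ → good? k (word₀ σ)) (permutations (suc (k * M))))
  clusters-maximal k = begin
    clusters (suc (k * M)) k ≡⟨ sym (∑permutations (suc (k * M)) (λ w → cluster 1 w k)) ⟩
    ∑list (permutations (suc (k * M))) (λ σ → cluster 1 (word₀ σ) k)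
      ≡⟨ ∑list-cong (permutations (suc (k * M))) (λ σ → cluster-maximal k (word₀ σ) (length-word₀ σ)) ⟩
    ∑list (permutations (suc (k * M))) (λ σ → indicator (good? k (word₀ σ)))
      ≡⟨ sym (length-filter-∑ (λ σ → good? k (word₀ σ)) (permutations (suc (k * M)))) ⟩
    length (filter (λ σ → good? k (word₀ σ)) (permutations (suc (k * M)))) ∎
    where open ≡-Reasoning

  drop-block : ∀ i (w : List ℕ) → drop (i * M) (drop M w) ≡ drop (suc i * M) w
  drop-block i w = Listₚ.drop-drop M (i * M) w

  Good⇒Occurs : ∀ k w → Good k w → ∀ i → i < k → Occurs (drop (i * M) w)
  Good⇒Occurs (suc k) w (o , g) zero    _       = o
  Good⇒Occurs (suc k) w (o , g) (suc i) (s≤s l) =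
    subst Occurs (drop-block i w) (Good⇒Occurs k (drop M w) g i l)

  Occurs⇒Good : ∀ k w → (∀ i → i < k → Occurs (drop (i * M) w)) → Good k w
  Occurs⇒Good zero    w o = tt
  Occurs⇒Good (suc k) w o = o 0 (s≤s z≤n) ,
    Occurs⇒Good k (drop M w) λ i l → subst Occurs (sym (drop-block i w)) (o (suc i) (s≤s l))

-- Counting permutations by injections.

all-lookup : ∀ {P : A → Set} {xs} → All P xs → ∀ i → P (lookup xs i)
all-lookup (p ∷ ps) zero    = p
all-lookup (p ∷ ps) (suc i) = all-lookup ps i

module _ {n : ℕ} where
  private S = Permutation-setoid n

  lookup-unique : ∀ {xs : List (Permutation′ n)} → AllPairs (λ σ τ → ¬ Setoid._≈_ S σ τ) xs →
    ∀ i j → Setoid._≈_ S (lookup xs i) (lookup xs j) → i ≡ j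
  lookup-unique (p ∷ ps) zero    zero    e = refl
  lookup-unique (p ∷ ps) zero    (suc j) e = contradiction e (all-lookup p j)
  lookup-unique (p ∷ ps) (suc i) zero    e =
    contradiction (λ x → sym (e x)) (all-lookup p i)
  lookup-unique (p ∷ ps) (suc i) (suc j) e = cong suc (lookup-unique ps i j e)

  module _ {P : Permutation′ n → Set} (P? : ∀ σ → Dec (P σ)) where
    private good = filter P? (permutations n)

    count-≤ : ∀ {N} (code : Permutation′ n → Fin N) →
      (∀ σ τ → P σ → P τ → code σ ≡ code τ → Setoid._≈_ S σ τ) → length good ≤ N
    count-≤ code inj = Finₚ.injective⇒≤ {f = code ∘ lookup good} λ {i} {j} e →
      lookup-unique (AllPairsₚ.filter⁺ P? (permutations-unique n)) i j
        (inj _ _ (holds i) (holds j) e)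
      where
        holds : ∀ i → P (lookup good i)
        holds = all-lookup (Allₚ.all-filter P? (permutations n))

    -- Permutations are listed up to pointwise equality, so `make t` itself need not be in the list;
    -- `resp` moves the property to its listed representative, whose index determines `t`.
    count-≥ : ∀ {N} (make : Fin N → Permutation′ n) → (∀ {σ τ} → Setoid._≈_ S σ τ → P σ → P τ) →
      (∀ t → P (make t)) → (∀ t t′ → Setoid._≈_ S (make t) (make t′) → t ≡ t′) → N ≤ length good
    count-≥ make resp holds inj = Finₚ.injective⇒≤ {f = λ t → Any.index (member t)} λ {t} {t′} e →
      inj t t′ (Membershipₚ.index-injective S {make t} {make t′} (member t) (member t′) e)
      where
        member : ∀ t → Membership._∈_ S (make t) good
        member t = Membershipₚ.∈-filter⁺ S P? (λ {σ} {τ} → resp {σ} {τ}) (permutations-complete (make t)) (holds t)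

clamp : ∀ {N} → ℕ → Fin (suc N)
clamp {N} p = fromℕ< (s≤s (m⊓n≤n p N))

toℕ-clamp : ∀ {N p} → p ≤ N → toℕ (clamp {N} p) ≡ p
toℕ-clamp p≤N = trans (Finₚ.toℕ-fromℕ< _) (m≤n⇒m⊓n≡m p≤N)

at-clamp : ∀ {N} (σ : Permutation′ (suc N)) {p} → p ≤ N → at (word₀ σ) p ≡ toℕ (σ ⟨$⟩ʳ clamp p)
at-clamp σ {p} l = trans (cong (at (word₀ σ)) (sym (toℕ-clamp l))) (at-word₀ σ (clamp p))

at-bound : ∀ {N} (σ : Permutation′ (suc N)) {p} → p ≤ N → at (word₀ σ) p ≤ N
at-bound σ l = subst (_≤ _) (sym (at-clamp σ l)) (s≤s⁻¹ (Finₚ.toℕ<n (σ ⟨$⟩ʳ clamp _)))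

at-inverse : ∀ {N} (σ : Permutation′ (suc N)) {p} → p ≤ N → at (word₀ (flip σ)) (at (word₀ σ) p) ≡ p
at-inverse σ {p} l = begin
  at (word₀ (flip σ)) (at (word₀ σ) p)       ≡⟨ cong (at (word₀ (flip σ))) (at-clamp σ l) ⟩
  at (word₀ (flip σ)) (toℕ (σ ⟨$⟩ʳ clamp p)) ≡⟨ at-word₀ (flip σ) _ ⟩
  toℕ (σ ⟨$⟩ˡ (σ ⟨$⟩ʳ clamp p))              ≡⟨ cong toℕ (Perm.inverseˡ σ) ⟩
  toℕ (clamp p)                              ≡⟨ toℕ-clamp l ⟩
  p ∎
  where open ≡-Reasoning

at-inverse′ : ∀ {N} (σ : Permutation′ (suc N)) {p} → p ≤ N → at (word₀ σ) (at (word₀ (flip σ)) p) ≡ p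
at-inverse′ σ l = at-inverse (flip σ) l

at-injective : ∀ {N} (σ : Permutation′ (suc N)) {p q} → p ≤ N → q ≤ N →
  at (word₀ σ) p ≡ at (word₀ σ) q → p ≡ q
at-injective σ p≤N q≤N e =
  trans (sym (at-inverse σ p≤N)) (trans (cong (at (word₀ (flip σ))) e) (at-inverse σ q≤N))

⟨$⟩ʳ-injective : ∀ {n} (σ : Permutation′ n) {i j} → σ ⟨$⟩ʳ i ≡ σ ⟨$⟩ʳ j → i ≡ j
⟨$⟩ʳ-injective σ e = trans (sym (Perm.inverseˡ σ)) (trans (cong (σ ⟨$⟩ˡ_) e) (Perm.inverseˡ σ))

-- Pigeonhole: if a value were missed, `punchOut` would inject the domain into a set with one
-- element fewer.
fromInjection : ∀ {n} (f : Fin n → Fin n) → (∀ {i j} → f i ≡ f j → i ≡ j) → Permutation′ n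
fromInjection {n} f inj = Perm.permutation f (proj₁ ∘ onto) (proj₂ ∘ onto) (λ i → inj (proj₂ (onto (f i))))
  where
    onto : ∀ y → ∃[ x ] f x ≡ y
    onto y with Finₚ.any? (λ x → f x Finₚ.≟ y)
    ... | yes found = found
    ... | no  none  = ⊥-elim (absurd f inj y λ x e → none (x , e))
      where
        absurd : ∀ {n} (f : Fin n → Fin n) → (∀ {i j} → f i ≡ f j → i ≡ j) → ∀ y → (∀ x → f x ≢ y) → ⊥
        absurd {suc n} f inj y miss = <⇒≱ (n<1+n n) (Finₚ.injective⇒≤
          {f = λ x → Fin.punchOut (miss x ∘ sym)} λ {i} {j} e → inj (Finₚ.punchOut-injective (miss i ∘ sym) (miss j ∘ sym) e))

-- In a permutation of length k M + 1 with occurrences of π at the positions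
-- 0, M, …, (k-1) M, the entries of rank a, …, a + d in the successive blocks
-- form a single increasing chain of length k d + 1, since the last letter of a
-- block (rank a + d) is the first letter (rank a) of the next one.  The other a + c
-- ranks are enumerated by offRank.

module Blocks {m} (π : Permutation′ (suc (suc m))) (a d c : ℕ)
  (π-first : at (word₀ π) 0 ≡ a) (π-last : at (word₀ π) (suc m) ≡ a + d) (M≡ : suc m ≡ a + (d + c)) (0<d : 0 < d)
  (k : ℕ) where

  M = suc m
  N = k * M

  open Occurrences π public
  open Chain π public

  place : ℕ → ℕ
  place R = at (word₀ (flip π)) R

  a+d≤M : a + d ≤ M
  a+d≤M = subst (a + d ≤_) (sym M≡) (+-monoʳ-≤ a (m≤m+n d c))

  a≤M : a ≤ M
  a≤M = ≤-trans (m≤m+n a d) a+d≤M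

  place-a : place a ≡ 0
  place-a = trans (cong place (sym π-first)) (at-inverse π z≤n)

  place-a+d : place (a + d) ≡ M
  place-a+d = trans (cong place (sym π-last)) (at-inverse π ≤-refl)

  rank-place : ∀ {R} → R ≤ M → at (word₀ π) (place R) ≡ R
  rank-place = at-inverse′ π

  place≤M : ∀ {R} → R ≤ M → place R ≤ M
  place≤M = at-bound (flip π)

  position≤N : ∀ {i q} → i < k → q ≤ M → i * M + q ≤ N
  position≤N {i} {q} i<k q≤M = ≤-trans (+-monoʳ-≤ (i * M) q≤M)
    (subst (_≤ N) (+-comm M (i * M)) (*-monoˡ-≤ M i<k))

  offRank : ℕ → ℕ
  offRank r with r <? a
  ... | yes _ = r
  ... | no  _ = suc (d + r)

  offRank≤M : ∀ {r} → r < a + c → offRank r ≤ M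
  offRank≤M {r} l with r <? a
  ... | yes r<a = ≤-trans (<⇒≤ r<a) a≤M
  ... | no  _   = subst₂ _≤_ (+-suc d r) eq (+-monoʳ-≤ d l)
    where
      eq : d + (a + c) ≡ M
      eq = trans (sym (+-assoc d a c)) (trans (cong (_+ c) (+-comm d a)) (trans (+-assoc a d c) (sym M≡)))

  -- Unique coordinates for positions. A letter shared by two blocks counts as rank `a` of the later
  -- one, so rank `a + d` is excluded; the final position `N` is rank `a` of a fictitious block `k`.
  Valid : ℕ → ℕ → Set
  Valid i R = (i < k × R ≤ M × R ≢ a + d) ⊎ (i ≡ k × R ≡ a)

  decompose : ∀ p → p ≤ N → ∃₂ λ i R → Valid i R × p ≡ i * M + place R
  decompose p p≤N with m≤n⇒m<n∨m≡n p≤N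
  ... | inj₂ refl = k , a , inj₂ (refl , refl) , sym (trans (cong (N +_) place-a) (+-identityʳ N))
  ... | inj₁ p<N  = p / M , at (word₀ π) (p % M) , inj₁ (i<k , at-bound π q≤M , R≢) ,
    trans (m≡m%n+[m/n]*n p M) (trans (+-comm (p % M) _) (cong (p / M * M +_) (sym (at-inverse π q≤M))))
    where
      q≤M : p % M ≤ M
      q≤M = <⇒≤ (m%n<n p M)
      i<k : p / M < k
      i<k = m<n*o⇒m/o<n p<N
      R≢ : at (word₀ π) (p % M) ≢ a + d
      R≢ e = <⇒≢ (m%n<n p M) (at-injective π q≤M ≤-refl (trans e (sym π-last)))

  data Kind (p : ℕ) : Set where
    off   : ∀ i r → i < k → r < a + c → p ≡ i * M + place (offRank r) → Kind p
    chain : ∀ i R → a ≤ R → R < a + d → i < k ⊎ (i ≡ k × R ≡ a) → p ≡ i * M + place R → Kind p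

  kind : ∀ p → p ≤ N → Kind p
  kind p p≤N with decompose p p≤N
  ... | i , R , inj₂ (i≡k , refl) , e = chain i a ≤-refl (m<m+n a 0<d) (inj₂ (i≡k , refl)) e
  ... | i , R , inj₁ (i<k , R≤M , R≢) , e with R <? a
  ...   | yes R<a = off i R i<k (<-≤-trans R<a (m≤m+n a c)) (trans e (cong (λ R → i * M + place R) (sym same)))
    where
      same : offRank R ≡ R
      same with R <? a
      ... | yes _   = refl
      ... | no  R≮a = contradiction R<a R≮a
  ...   | no  R≮a with R <? a + d
  ...     | yes R<a+d = chain i R (≮⇒≥ R≮a) R<a+d (inj₁ i<k) e
  ...     | no  R≮a+d = off i r i<k r<a+c (trans e (cong (λ R → i * M + place R) (sym same)))
    where
      beyond : suc (a + d) ≤ R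
      beyond = ≤∧≢⇒< (≮⇒≥ R≮a+d) (R≢ ∘ sym)
      r = R ∸ suc d
      suc-d≤R : suc d ≤ R
      suc-d≤R = ≤-trans (s≤s (m≤n+m d a)) beyond
      R≡ : suc d + r ≡ R
      R≡ = m+[n∸m]≡n suc-d≤R
      a≤r : a ≤ r
      a≤r = +-cancelˡ-≤ (suc d) a r (subst₂ _≤_ (cong suc (+-comm a d)) (sym R≡) beyond)
      r<a+c : r < a + c
      r<a+c = +-cancelˡ-≤ d (suc r) (a + c) (subst₂ _≤_ (sym (trans (+-suc d r) R≡))
        (trans M≡ (trans (sym (+-assoc a d c)) (trans (cong (_+ c) (+-comm a d)) (+-assoc d a c)))) R≤M)
      same : offRank r ≡ R
      same with r <? a
      ... | yes r<a = contradiction r<a (≤⇒≯ a≤r)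
      ... | no  _   = R≡

  module _ {w : List ℕ} (g : Good k w) where

    block-order : ∀ {i R R′} → i < k → R < R′ → R′ ≤ M →
      at w (i * M + place R) < at w (i * M + place R′)
    block-order {i} {R} {R′} i<k R<R′ R′≤M = subst₂ _<_ (at-drop (i * M) w _) (at-drop (i * M) w _)
      (Occurs⇒order π (drop (i * M) w) (Good⇒Occurs k w g i i<k) (place≤M R≤M) (place≤M R′≤M)
        (subst₂ _<_ (sym (rank-place R≤M)) (sym (rank-place R′≤M)) R<R′))
      where R≤M = ≤-trans (<⇒≤ R<R′) R′≤M

    at-next : ∀ i → at w (i * M + place (a + d)) ≡ at w (suc i * M + place a)
    at-next i = cong (at w) (trans (cong (i * M +_) place-a+d) (trans (+-comm (i * M) M)
      (sym (trans (cong (suc i * M +_) place-a) (+-identityʳ _)))))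

    heads-order : ∀ {i j} → i ≤ j → j ≤ k → at w (i * M + place a) ≤ at w (j * M + place a)
    heads-order {i} {j} i≤j j≤k with m≤n⇒m<n∨m≡n i≤j
    ... | inj₂ refl = ≤-refl
    heads-order {i} {suc j} i≤j j<k | inj₁ (s≤s i≤j′) = ≤-trans (heads-order i≤j′ (<⇒≤ j<k))
      (<⇒≤ (<-≤-trans (block-order j<k (m<m+n a 0<d) a+d≤M) (≤-reflexive (at-next j))))

    -- The comparison runs from rank `R` up to the end of block `i`, which is the first letter of
    -- the next block, along the first letters up to block `j`, and from there up to rank `R′`.
    chain-order : ∀ {i R j R′} → a ≤ R′ → R′ < a + d → R < a + d → j < k ⊎ (j ≡ k × R′ ≡ a) →
      i < j → at w (i * M + place R) < at w (j * M + place R′)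
    chain-order {i} {R} {j} {R′} a≤R′ R′<a+d R<a+d v i<j = <-≤-trans
      (block-order (<-≤-trans i<j j≤k) R<a+d a+d≤M)
      (≤-trans (≤-reflexive (at-next i)) (≤-trans (heads-order i<j j≤k) (within v)))
      where
        j≤k : j ≤ k
        j≤k = case v of λ { (inj₁ j<k) → <⇒≤ j<k ; (inj₂ (j≡k , _)) → ≤-reflexive j≡k }
        within : j < k ⊎ (j ≡ k × R′ ≡ a) → at w (j * M + place a) ≤ at w (j * M + place R′)
        within (inj₂ (_ , refl)) = ≤-refl
        within (inj₁ j<k) with m≤n⇒m<n∨m≡n a≤R′
        ... | inj₂ refl = ≤-refl
        ... | inj₁ a<R′ = <⇒≤ (block-order j<k a<R′ (≤-trans (<⇒≤ R′<a+d) a+d≤M))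

  -- The order is the same in all good words, so that it can be used for two permutations at once.
  Comparable : ℕ → ℕ → Set
  Comparable p q = p ≡ q ⊎ (∀ {w} → Good k w → at w p < at w q) ⊎ (∀ {w} → Good k w → at w q < at w p)

  same-block : ∀ {i R R′ p q} → i < k ⊎ (i ≡ k × R ≡ a) → i < k ⊎ (i ≡ k × R′ ≡ a) →
    R < a + d → R′ < a + d → p ≡ i * M + place R → q ≡ i * M + place R′ → Comparable p q
  same-block {i} {R} {R′} v v′ l l′ refl refl with <-cmp R R′
  ... | tri≈ _ refl _ = inj₁ refl
  ... | tri< R<R′ _ _ = inj₂ (inj₁ λ g → block-order g (inside v v′) R<R′ (≤-trans (<⇒≤ l′) a+d≤M))
    where
      inside : i < k ⊎ (i ≡ k × R ≡ a) → i < k ⊎ (i ≡ k × R′ ≡ a) → i < k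
      inside (inj₁ i<k)        _                  = i<k
      inside (inj₂ _)          (inj₁ i<k)         = i<k
      inside (inj₂ (_ , refl)) (inj₂ (_ , refl)) = contradiction R<R′ (<-irrefl refl)
  ... | tri> _ _ R′<R = inj₂ (inj₂ λ g → block-order g (inside v v′) R′<R (≤-trans (<⇒≤ l) a+d≤M))
    where
      inside : i < k ⊎ (i ≡ k × R ≡ a) → i < k ⊎ (i ≡ k × R′ ≡ a) → i < k
      inside (inj₁ i<k)        _                  = i<k
      inside (inj₂ _)          (inj₁ i<k)         = i<k
      inside (inj₂ (_ , refl)) (inj₂ (_ , refl)) = contradiction R′<R (<-irrefl refl)

  chain-comparable : ∀ {i R j R′ p q} → a ≤ R → R < a + d → i < k ⊎ (i ≡ k × R ≡ a) → p ≡ i * M + place R →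
    a ≤ R′ → R′ < a + d → j < k ⊎ (j ≡ k × R′ ≡ a) → q ≡ j * M + place R′ → Comparable p q
  chain-comparable {i} {R} {j} {R′} a≤R R<a+d v refl a≤R′ R′<a+d v′ refl with <-cmp i j
  ... | tri< i<j _ _  = inj₂ (inj₁ λ g → chain-order g a≤R′ R′<a+d R<a+d v′ i<j)
  ... | tri≈ _ refl _ = same-block v v′ R<a+d R′<a+d refl refl
  ... | tri> _ _ j<i  = inj₂ (inj₂ λ g → chain-order g a≤R R<a+d R′<a+d v j<i)

  -- Upper bound: the entries off the chain determine the cluster.

  AgreeOff : (σ τ : Permutation′ (suc N)) → Set
  AgreeOff σ τ = ∀ i r → i < k → r < a + c →
    at (word₀ σ) (i * M + place (offRank r)) ≡ at (word₀ τ) (i * M + place (offRank r))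

  Transfers : (σ τ : Permutation′ (suc N)) → ℕ → Set
  Transfers σ τ v = ∀ p → p ≤ N → at (word₀ σ) p ≡ v → at (word₀ τ) p ≡ v

  -- If v is at the chain position p in σ but at another chain position q in τ,
  -- the earlier of p and q in the chain holds a value below v in the other
  -- permutation, hence by induction that same value, not v, in its own.

  transfers-step : ∀ (σ τ : Permutation′ (suc N)) → Good k (word₀ σ) → Good k (word₀ τ) → AgreeOff σ τ →
    ∀ v → (∀ v′ → v′ < v → Transfers σ τ v′ × Transfers τ σ v′) → Transfers σ τ v
  transfers-step σ τ gσ gτ agree v IH p p≤N σp≡v = by-kind (kind p p≤N) (kind q q≤N)
    where
      v≤N : v ≤ N
      v≤N = subst (_≤ N) σp≡v (at-bound σ p≤N)
      q = at (word₀ (flip τ)) v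
      q≤N : q ≤ N
      q≤N = at-bound (flip τ) v≤N
      τq≡v : at (word₀ τ) q ≡ v
      τq≡v = at-inverse′ τ v≤N
      via-order : Comparable p q → at (word₀ τ) p ≡ v
      via-order (inj₁ p≡q) = trans (cong (at (word₀ τ)) p≡q) τq≡v
      via-order (inj₂ (inj₁ p<q)) = contradiction
        (trans (sym (proj₂ (IH _ τp<v) p p≤N refl)) σp≡v) (<⇒≢ τp<v)
        where
          τp<v : at (word₀ τ) p < v
          τp<v = subst (at (word₀ τ) p <_) τq≡v (p<q gτ)
      via-order (inj₂ (inj₂ q<p)) = contradiction
        (trans (sym (proj₁ (IH _ σq<v) q q≤N refl)) τq≡v) (<⇒≢ σq<v)
        where
          σq<v : at (word₀ σ) q < v
          σq<v = subst (at (word₀ σ) q <_) σp≡v (q<p gσ)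
      by-kind : Kind p → Kind q → at (word₀ τ) p ≡ v
      by-kind (off i r i<k r<e e) _ =
        trans (cong (at (word₀ τ)) e) (trans (sym (agree i r i<k r<e)) (trans (cong (at (word₀ σ)) (sym e)) σp≡v))
      by-kind (chain _ _ _ _ _ _) (off i r i<k r<e e) = trans (cong (at (word₀ τ)) p≡q) τq≡v
        where
          p≡q : p ≡ q
          p≡q = at-injective σ p≤N q≤N (trans σp≡v (sym (trans (cong (at (word₀ σ)) e)
            (trans (agree i r i<k r<e) (trans (cong (at (word₀ τ)) (sym e)) τq≡v)))))
      by-kind (chain i R l u x e) (chain j R′ l′ u′ x′ e′) = via-order (chain-comparable l u x e l′ u′ x′ e′)

  -- Strong induction on the value, in both directions at once because the step uses both for
  -- smaller values.
  transfers : ∀ (σ τ : Permutation′ (suc N)) → Good k (word₀ σ) → Good k (word₀ τ) → AgreeOff σ τ →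
    ∀ V v → v < V → Transfers σ τ v × Transfers τ σ v
  transfers σ τ gσ gτ agree (suc V) v (s≤s v≤V) =
    transfers-step σ τ gσ gτ agree v below ,
    transfers-step τ σ gτ gσ (λ i r l l′ → sym (agree i r l l′)) v (λ v′ l → proj₂ (below v′ l) , proj₁ (below v′ l))
    where
      below : ∀ v′ → v′ < v → Transfers σ τ v′ × Transfers τ σ v′
      below v′ v′<v = transfers σ τ gσ gτ agree V v′ (<-≤-trans v′<v v≤V)

  code : Permutation′ (suc N) → Fin ((suc N ^ k) ^ (a + c))
  code σ = Fin.funToFin {a + c} λ r → Fin.funToFin {k} λ i → σ ⟨$⟩ʳ clamp (toℕ i * M + place (offRank (toℕ r)))

  code-injective : ∀ σ τ → Good k (word₀ σ) → Good k (word₀ τ) → code σ ≡ code τ →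
    ∀ i → σ ⟨$⟩ʳ i ≡ τ ⟨$⟩ʳ i
  code-injective σ τ gσ gτ e i = Finₚ.toℕ-injective (trans (sym (at-word₀ σ i)) (trans
    (sym (proj₁ (transfers σ τ gσ gτ agree (suc (at (word₀ σ) (toℕ i))) _ ≤-refl) (toℕ i)
      (s≤s⁻¹ (Finₚ.toℕ<n i)) refl)) (at-word₀ τ i)))
    where
      digits : ∀ {K n} {f g : Fin K → Fin n} → Fin.funToFin f ≡ Fin.funToFin g → ∀ j → f j ≡ g j
      digits {f = f} {g} e j = trans (sym (Finₚ.finToFun-funToFin f j))
        (trans (cong (λ x → Fin.finToFun x j) e) (Finₚ.finToFun-funToFin g j))
      agree : AgreeOff σ τ
      agree i r i<k r<e = trans (at-clamp σ bound) (trans (cong toℕ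
        (subst₂ (λ i r → σ ⟨$⟩ʳ clamp (i * M + place (offRank r)) ≡ τ ⟨$⟩ʳ clamp (i * M + place (offRank r)))
          (Finₚ.toℕ-fromℕ< i<k) (Finₚ.toℕ-fromℕ< r<e) (digits (digits e (fromℕ< r<e)) (fromℕ< i<k))))
        (sym (at-clamp τ bound)))
        where
          bound : i * M + place (offRank r) ≤ N
          bound = position≤N i<k (place≤M (offRank≤M r<e))

  clusters-upper : clusters (suc N) k ≤ (suc N ^ k) ^ (a + c)
  clusters-upper = subst (_≤ (suc N ^ k) ^ (a + c)) (sym (clusters-maximal k))
    (count-≤ (λ σ → good? k (word₀ σ)) code code-injective)

  -- Lower bound: fillings built from freely chosen orders.

  data Zone (R : ℕ) : Set where
    low  : R < a → Zone R
    mid  : ∀ t → t ≤ d → R ≡ a + t → Zone R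
    high : ∀ t → R ≡ a + suc (d + t) → Zone R

  zone : ∀ R → Zone R
  zone R with R <? a
  ... | yes R<a = low R<a
  ... | no  R≮a with R ∸ a ≤? d
  ...   | yes t≤d = mid (R ∸ a) t≤d (sym (m+[n∸m]≡n (≮⇒≥ R≮a)))
  ...   | no  t≰d = high (R ∸ a ∸ suc d) (sym (trans (cong (a +_) (m+[n∸m]≡n (≰⇒> t≰d))) (m+[n∸m]≡n (≮⇒≥ R≮a))))

  -- A filling puts all the entries of rank below a first, then the chain, then
  -- all the entries of rank above a + d.  The entries of a given off-chain rank
  -- in the k blocks occupy an interval of k values, in an order ρ chosen freely.

  module Fill (ρ : ℕ → ℕ → ℕ) (ρ<k : ∀ r i → ρ r i < k)
    (ρ-inj : ∀ {r i j} → r < a + c → i < k → j < k → ρ r i ≡ ρ r j → i ≡ j) where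

    -- The chain takes the values from `a * k` to `a * k + k * d`, with `k` values for each lower
    -- rank before it and for each higher rank after it. The row `a + t` of `ρ` is the index that
    -- `offRank` sends to the rank `a + suc (d + t)`.
    value : ∀ {R} → ℕ → Zone R → ℕ
    value {R} i (low _)     = R * k + ρ R i
    value     i (mid t _ _) = a * k + (i * d + t)
    value     i (high t _)  = suc (a * k + k * d) + (t * k + ρ (a + t) i)

    slot-< : ∀ {n x y u v} → x < y → u < n → x * n + u < y * n + v
    slot-< {n} {x} {y} {u} {v} x<y u<n = begin-strict
      x * n + u <⟨ +-monoʳ-< (x * n) u<n ⟩
      x * n + n ≡⟨ +-comm (x * n) n ⟩
      suc x * n ≤⟨ *-monoˡ-≤ n x<y ⟩
      y * n     ≤⟨ m≤m+n (y * n) v ⟩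
      y * n + v ∎
      where open ≤-Reasoning

    slot-injective : ∀ {n x y u v} → u < n → v < n → x * n + u ≡ y * n + v → x ≡ y × u ≡ v
    slot-injective {n} {x} {y} u<n v<n e with <-cmp x y
    ... | tri< x<y _ _  = contradiction e (<⇒≢ (slot-< x<y u<n))
    ... | tri≈ _ refl _ = refl , +-cancelˡ-≡ (x * n) _ _ e
    ... | tri> _ _ y<x  = contradiction (sym e) (<⇒≢ (slot-< y<x v<n))

    low<ak : ∀ {R} i → R < a → R * k + ρ R i < a * k
    low<ak {R} i R<a = <-≤-trans (slot-< R<a (ρ<k R i)) (≤-reflexive (+-identityʳ (a * k)))

    mid≤ : ∀ {i t} → i < k → t ≤ d → a * k + (i * d + t) ≤ a * k + k * d
    mid≤ {i} {t} i<k t≤d = +-monoʳ-≤ (a * k) (begin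
      i * d + t ≤⟨ +-monoʳ-≤ (i * d) t≤d ⟩
      i * d + d ≡⟨ +-comm (i * d) d ⟩
      suc i * d ≤⟨ *-monoˡ-≤ d i<k ⟩
      k * d     ∎)
      where open ≤-Reasoning

    value-mono : ∀ {i R R′} → i < k → R < R′ → (z : Zone R) (z′ : Zone R′) → value i z < value i z′
    value-mono {i} i<k R<R′ (low x)         (low y)         = slot-< R<R′ (ρ<k _ i)
    value-mono {i} i<k R<R′ (low x)         (mid t _ _)     = <-≤-trans (low<ak i x) (m≤m+n (a * k) _)
    value-mono {i} i<k R<R′ (low x)         (high t _)      = <-≤-trans (low<ak i x)
      (≤-trans (m≤m+n (a * k) (k * d)) (≤-trans (n≤1+n _) (m≤m+n (suc (a * k + k * d)) _)))
    value-mono {i} i<k R<R′ (mid t _ refl)  (low y)         = contradiction (<-trans R<R′ y) (≤⇒≯ (m≤m+n a t))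
    value-mono {i} i<k R<R′ (mid t _ refl)  (mid t′ _ refl) =
      +-monoʳ-< (a * k) (+-monoʳ-< (i * d) (+-cancelˡ-< a t t′ R<R′))
    value-mono {i} i<k R<R′ (mid t l refl)  (high t′ _)     =
      ≤-trans (s≤s (mid≤ i<k l)) (m≤m+n (suc (a * k + k * d)) _)
    value-mono {i} i<k R<R′ (high t refl)   (low y)         = contradiction (<-trans R<R′ y) (≤⇒≯ (m≤m+n a _))
    value-mono {i} i<k R<R′ (high t refl)   (mid t′ l refl) =
      contradiction (+-cancelˡ-< a _ t′ R<R′) (≤⇒≯ (≤-trans l (≤-trans (m≤m+n d t) (n≤1+n _))))
    value-mono {i} i<k R<R′ (high t refl)   (high t′ refl)  = +-monoʳ-< (suc (a * k + k * d))
      (slot-< (+-cancelˡ-< d t t′ (s<s⁻¹ (+-cancelˡ-< a _ _ R<R′))) (ρ<k _ i))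

    -- Excluding rank `a + d` makes `t` a proper digit in base `d`, so that `i * d + t` determines
    -- both `i` and `t`.
    open-slot : ∀ {i R t} → Valid i R → R ≡ a + t → t ≤ d → t < d
    open-slot (inj₁ (_ , _ , R≢)) refl t≤d = ≤∧≢⇒< t≤d λ { refl → R≢ refl }
    open-slot {t = t} (inj₂ (_ , a≡)) refl t≤d =
      subst (_< d) (sym (+-cancelˡ-≡ a t 0 (trans a≡ (sym (+-identityʳ a))))) 0<d

    mid<high : ∀ {i R t} → Valid i R → R ≡ a + t → t ≤ d → a * k + (i * d + t) < suc (a * k + k * d)
    mid<high (inj₁ (i<k , _)) refl t≤d = s≤s (mid≤ i<k t≤d)
    mid<high {t = t} (inj₂ (refl , a≡)) refl t≤d = s≤s (≤-reflexive (cong (a * k +_)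
      (trans (cong (k * d +_) (+-cancelˡ-≡ a t 0 (trans a≡ (sym (+-identityʳ a))))) (+-identityʳ _))))

    bound : ∀ {i R} → Valid i R → R ≢ a → i < k × R ≤ M
    bound (inj₁ (i<k , R≤M , _)) _ = i<k , R≤M
    bound (inj₂ (_ , e)) R≢a       = contradiction e R≢a

    high-rank : ∀ {t} → a + suc (d + t) ≤ M → t < c
    high-rank {t} l = +-cancelˡ-≤ d (suc t) c (subst (_≤ d + c) (sym (+-suc d t))
      (+-cancelˡ-≤ a _ _ (subst (a + suc (d + t) ≤_) M≡ l)))

    high≢a : ∀ {R t} → R ≡ a + suc (d + t) → R ≢ a
    high≢a {t = t} refl e = <⇒≢ (m<m+n a (s≤s z≤n)) (sym e)

    value-injective : ∀ {i R i′ R′} → Valid i R → Valid i′ R′ → (z : Zone R) (z′ : Zone R′) →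
      value i z ≡ value i′ z′ → i ≡ i′ × R ≡ R′
    value-injective {i} {R} {i′} {R′} v v′ (low x) (low y) e
      with slot-injective {k} {R} {R′} (ρ<k R i) (ρ<k R′ i′) e
    ... | refl , eρ = ρ-inj (<-≤-trans x (m≤m+n a c)) (proj₁ (bound v (<⇒≢ x))) (proj₁ (bound v′ (<⇒≢ y))) eρ , refl
    value-injective {i} v v′ (low x) (mid t _ _) e =
      contradiction e (<⇒≢ (<-≤-trans (low<ak i x) (m≤m+n (a * k) _)))
    value-injective {i} v v′ (low x) (high t _) e = contradiction e (<⇒≢ (<-≤-trans (low<ak i x)
      (≤-trans (m≤m+n (a * k) (k * d)) (≤-trans (n≤1+n _) (m≤m+n (suc (a * k + k * d)) _)))))
    value-injective {i} {i′ = i′} v v′ (mid t l p) (mid t′ l′ p′) e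
      with slot-injective {d} {i} {i′} (open-slot v p l) (open-slot v′ p′ l′) (+-cancelˡ-≡ (a * k) _ _ e)
    ... | refl , refl = refl , trans p (sym p′)
    value-injective v v′ (mid t l p) (high t′ _) e =
      contradiction e (<⇒≢ (<-≤-trans (mid<high v p l) (m≤m+n (suc (a * k + k * d)) _)))
    value-injective {i} {i′ = i′} v v′ (high t p) (high t′ p′) e
      with slot-injective {k} {t} {t′} (ρ<k (a + t) i) (ρ<k (a + t′) i′) (+-cancelˡ-≡ (suc (a * k + k * d)) _ _ e)
    ... | refl , eρ with bound v (high≢a {t = t} p) | bound v′ (high≢a {t = t} p′)
    ...   | i<k , R≤M | i′<k , _ =
      ρ-inj (+-monoʳ-< a (high-rank (subst (_≤ M) p R≤M))) i<k i′<k eρ , trans p (sym p′)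
    value-injective v v′ (mid t l p) (low y) e = let i≡ , R≡ = value-injective v′ v (low y) (mid t l p) (sym e) in
      sym i≡ , sym R≡
    value-injective v v′ (high t p) (low y) e = let i≡ , R≡ = value-injective v′ v (low y) (high t p) (sym e) in
      sym i≡ , sym R≡
    value-injective v v′ (high t p) (mid t′ l p′) e =
      let i≡ , R≡ = value-injective v′ v (mid t′ l p′) (high t p) (sym e) in sym i≡ , sym R≡

    N≡ : N ≡ (a * k + k * d) + c * k
    N≡ = begin
      k * M               ≡⟨ cong (k *_) M≡ ⟩
      k * (a + (d + c))   ≡⟨ *-distribˡ-+ k a (d + c) ⟩
      k * a + k * (d + c) ≡⟨ cong₂ _+_ (*-comm k a) (*-distribˡ-+ k d c) ⟩
      a * k + (k * d + k * c) ≡⟨ sym (+-assoc (a * k) _ _) ⟩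
      (a * k + k * d) + k * c ≡⟨ cong (a * k + k * d +_) (*-comm k c) ⟩
      (a * k + k * d) + c * k ∎
      where open ≡-Reasoning

    value≤N : ∀ {i R} → Valid i R → (z : Zone R) → value i z ≤ N
    value≤N {i} v z = subst (value i z ≤_) (sym N≡) (go z)
      where
        go : (z : Zone _) → value i z ≤ (a * k + k * d) + c * k
        go (low x)     = ≤-trans (<⇒≤ (low<ak i x)) (≤-trans (m≤m+n (a * k) (k * d)) (m≤m+n _ (c * k)))
        go (mid t l p) = ≤-trans (s≤s⁻¹ (mid<high v p l)) (m≤m+n _ (c * k))
        go (high t p)  = subst (_≤ (a * k + k * d) + c * k) (+-suc (a * k + k * d) _)
          (+-monoʳ-≤ (a * k + k * d) (subst (t * k + ρ (a + t) i <_) (+-identityʳ (c * k))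
            (slot-< {k} {t} {c} (high-rank (subst (_≤ M) p (proj₂ (bound v (high≢a {t = t} p))))) (ρ<k _ i))))

    fill : ℕ → ℕ
    fill p = value (p / M) (zone (at (word₀ π) (p % M)))

    div-block : ∀ i {q} → q < M → (i * M + q) / M ≡ i
    div-block i {q} l = begin
      (i * M + q) / M   ≡⟨ /-congˡ (+-comm (i * M) q) ⟩
      (q + i * M) / M   ≡⟨ +-distrib-/-∣ʳ q (divides i refl) ⟩
      q / M + i * M / M ≡⟨ cong₂ _+_ (m<n⇒m/n≡0 l) (m*n/n≡m i M) ⟩
      i ∎
      where open ≡-Reasoning

    mod-block : ∀ i {q} → q < M → (i * M + q) % M ≡ q
    mod-block i {q} l = trans (%-congˡ (+-comm (i * M) q)) (trans ([m+kn]%n≡m%n q i M) (m<n⇒m%n≡m l))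

    fill-block : ∀ i {q} → q < M → fill (i * M + q) ≡ value i (zone (at (word₀ π) q))
    fill-block i l = cong₂ (λ i q → value i (zone (at (word₀ π) q))) (div-block i l) (mod-block i l)

    valid-place : ∀ {i R} → Valid i R → place R < M
    valid-place (inj₂ (_ , refl))        = subst (_< M) (sym place-a) (s≤s z≤n)
    valid-place (inj₁ (_ , R≤M , R≢)) = ≤∧≢⇒< (place≤M R≤M)
      λ e → R≢ (trans (sym (rank-place R≤M)) (trans (cong (at (word₀ π)) e) π-last))

    valid-rank : ∀ {i R} → Valid i R → R ≤ M
    valid-rank (inj₁ (_ , R≤M , _)) = R≤M
    valid-rank (inj₂ (_ , refl))    = a≤M

    fill-place : ∀ {i R} → Valid i R → fill (i * M + place R) ≡ value i (zone R)
    fill-place {i} v = trans (fill-block i (valid-place v)) (cong (λ R → value i (zone R)) (rank-place (valid-rank v)))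

    fill≤N : ∀ p → p ≤ N → fill p ≤ N
    fill≤N p p≤N with decompose p p≤N
    ... | i , R , v , refl = subst (_≤ N) (sym (fill-place v)) (value≤N v (zone R))

    fill-injective : ∀ p q → p ≤ N → q ≤ N → fill p ≡ fill q → p ≡ q
    fill-injective p q p≤N q≤N e with decompose p p≤N | decompose q q≤N
    ... | i , R , v , refl | i′ , R′ , v′ , refl
      with value-injective v v′ (zone R) (zone R′) (trans (sym (fill-place v)) (trans e (fill-place v′)))
    ...   | refl , refl = refl

    value-start : ∀ i (z : Zone a) → value i z ≡ a * k + i * d
    value-start i (low x)     = contradiction x (<-irrefl refl)
    value-start i (mid t _ p) = cong (a * k +_) (trans (cong (i * d +_)
      (+-cancelˡ-≡ a t 0 (trans (sym p) (sym (+-identityʳ a))))) (+-identityʳ _))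
    value-start i (high t p)  = contradiction refl (high≢a {t = t} p)

    value-end : ∀ i (z : Zone (a + d)) → value i z ≡ a * k + (d + i * d)
    value-end i (low x)     = contradiction x (≤⇒≯ (m≤m+n a d))
    value-end i (mid t _ p) = cong (a * k +_) (trans (cong (i * d +_) (sym (+-cancelˡ-≡ a d t p))) (+-comm (i * d) d))
    value-end i (high t p)  = contradiction (+-cancelˡ-≡ a d _ p) (<⇒≢ (s≤s (m≤m+n d t)))

    -- For `q = M` the division in `fill` assigns the position to block `suc i`; the value is still
    -- right because one block's segment of the chain ends where the next begins.
    fill-order : ∀ i {q} → q ≤ M → fill (i * M + q) ≡ value i (zone (at (word₀ π) q))
    fill-order i {q} q≤M with m≤n⇒m<n∨m≡n q≤M
    ... | inj₁ q<M  = fill-block i q<M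
    ... | inj₂ refl = begin
      fill (i * M + M)         ≡⟨ cong fill (trans (+-comm (i * M) M) (sym (+-identityʳ _))) ⟩
      fill (suc i * M + 0)     ≡⟨ fill-block (suc i) {0} (s≤s z≤n) ⟩
      value (suc i) (zone (at (word₀ π) 0)) ≡⟨ cong (λ R → value (suc i) (zone R)) π-first ⟩
      value (suc i) (zone a)   ≡⟨ value-start (suc i) (zone a) ⟩
      a * k + (d + i * d)      ≡⟨ sym (value-end i (zone (a + d))) ⟩
      value i (zone (a + d))   ≡⟨ cong (λ R → value i (zone R)) (sym π-last) ⟩
      value i (zone (at (word₀ π) M)) ∎
      where open ≡-Reasoning

    filling : Permutation′ (suc N)
    filling = fromInjection f λ {p} {q} e → Finₚ.toℕ-injective (fill-injective (toℕ p) (toℕ q) (≤N p) (≤N q)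
      (trans (sym (f≡ p)) (trans (cong toℕ e) (f≡ q))))
      where
        ≤N : (p : Fin (suc N)) → toℕ p ≤ N
        ≤N p = s≤s⁻¹ (Finₚ.toℕ<n p)
        f : Fin (suc N) → Fin (suc N)
        f p = clamp (fill (toℕ p))
        f≡ : ∀ p → toℕ (f p) ≡ fill (toℕ p)
        f≡ p = toℕ-clamp (fill≤N (toℕ p) (≤N p))

    at-filling : ∀ {p} → p ≤ N → at (word₀ filling) p ≡ fill p
    at-filling {p} l = trans (at-clamp filling l)
      (trans (toℕ-clamp (fill≤N _ (subst (_≤ N) (sym (toℕ-clamp l)) l))) (cong fill (toℕ-clamp l)))

    filling-good : Good k (word₀ filling)
    filling-good = Occurs⇒Good k (word₀ filling) λ i i<k →
      order⇒Occurs π {φ = λ R → value i (zone R)} (λ l → value-mono i<k l (zone _) (zone _))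
        (drop (i * M) (word₀ filling)) (long i i<k)
        λ p p≤M → trans (at-drop (i * M) (word₀ filling) p)
          (trans (at-filling (position≤N i<k p≤M)) (fill-order i p≤M))
      where
        long : ∀ i → i < k → suc M ≤ length (drop (i * M) (word₀ filling))
        long i i<k = subst (suc M ≤_) (sym (trans (Listₚ.length-drop (i * M) (word₀ filling))
          (cong (_∸ i * M) (length-word₀ filling))))
          (subst (_≤ suc N ∸ i * M) (trans (cong (_∸ i * M) (sym (+-suc (i * M) M))) (m+n∸m≡n (i * M) (suc M)))
            (∸-monoˡ-≤ (i * M) (s≤s (position≤N i<k ≤-refl))))

    offValid : ∀ {i r} → i < k → r < a + c → Valid i (offRank r)
    offValid {i} {r} i<k r<e = inj₁ (i<k , offRank≤M r<e , ≢)
      where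
        ≢ : offRank r ≢ a + d
        ≢ e with r <? a
        ... | yes r<a = <⇒≢ (<-≤-trans r<a (m≤m+n a d)) e
        ... | no  r≮a = <⇒≢ (≤-<-trans (+-monoˡ-≤ d (≮⇒≥ r≮a)) (s≤s (≤-reflexive (+-comm r d)))) (sym e)

  offset : ℕ → ℕ
  offset r with r <? a
  ... | yes _ = r * k
  ... | no  _ = suc (a * k + k * d) + (r ∸ a) * k

  -- The offset does not depend on `ρ`, so a filling reveals every `ρ r i` and different choices
  -- give different fillings.
  value-off : ∀ ρ (h : ∀ r i → ρ r i < k)
    (h′ : ∀ {r i j} → r < a + c → i < k → j < k → ρ r i ≡ ρ r j → i ≡ j) {i r} (z : Zone (offRank r)) →
    Fill.value ρ h h′ i z ≡ offset r + ρ r i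
  value-off ρ h h′ {i} {r} z with r <? a
  value-off ρ h h′ {i} {r} (low x)     | yes r<a = refl
  value-off ρ h h′ {i} {r} (mid t _ p) | yes r<a = contradiction r<a (≤⇒≯ (subst (a ≤_) (sym p) (m≤m+n a t)))
  value-off ρ h h′ {i} {r} (high t p)  | yes r<a = contradiction r<a (≤⇒≯ (subst (a ≤_) (sym p) (m≤m+n a _)))
  value-off ρ h h′ {i} {r} (low x)     | no  r≮a = contradiction (≤-<-trans (≤-trans (m≤n+m r d) (n≤1+n _)) x) r≮a
  value-off ρ h h′ {i} {r} (mid t l p) | no  r≮a = contradiction p (<⇒≢ (≤-<-trans (+-monoʳ-≤ a l)
    (s≤s (≤-trans (≤-reflexive (+-comm a d)) (+-monoʳ-≤ d (≮⇒≥ r≮a))))) ∘ sym)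
  value-off ρ h h′ {i} {r} (high t p)  | no  r≮a = trans
    (cong₂ (λ x y → suc (a * k + k * d) + (x * k + ρ y i)) (sym (trans (cong (_∸ a) r≡) (m+n∸m≡n a t))) (sym r≡))
    (sym (+-assoc (suc (a * k + k * d)) _ _))
    where
      r≡ : r ≡ a + t
      r≡ = +-cancelˡ-≡ d r (a + t) (suc-injective (trans p (trans (+-suc a (d + t)) (cong suc
        (trans (sym (+-assoc a d t)) (trans (cong (_+ t) (+-comm a d)) (+-assoc d a t)))))))

  module _ (0<k : 0 < k) where

    private
      perm : Fin (length (permutations k) ^ (a + c)) → Fin (a + c) → Permutation′ k
      perm t r = lookup (permutations k) (Fin.finToFun t r)

      ρ : Fin (length (permutations k) ^ (a + c)) → ℕ → ℕ → ℕ
      ρ t r i with r <? a + c | i <? k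
      ... | yes r<e | yes i<k = toℕ (perm t (fromℕ< r<e) ⟨$⟩ʳ fromℕ< i<k)
      -- The default outside the range must still be a value below `k`, hence the hypothesis
      -- `0 < k`.
      ... | _       | _       = 0

      ρ≡ : ∀ t (r : Fin (a + c)) (i : Fin k) → ρ t (toℕ r) (toℕ i) ≡ toℕ (perm t r ⟨$⟩ʳ i)
      ρ≡ t r i with toℕ r <? a + c | toℕ i <? k
      ... | yes r<e | yes i<k = cong₂ (λ r i → toℕ (perm t r ⟨$⟩ʳ i)) (Finₚ.fromℕ<-toℕ r r<e) (Finₚ.fromℕ<-toℕ i i<k)
      ... | no  r≮e | _       = contradiction (Finₚ.toℕ<n r) r≮e
      ... | yes _   | no  i≮k = contradiction (Finₚ.toℕ<n i) i≮k

      ρ<k : ∀ t r i → ρ t r i < k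
      ρ<k t r i with r <? a + c | i <? k
      ... | yes r<e | yes i<k = Finₚ.toℕ<n (perm t (fromℕ< r<e) ⟨$⟩ʳ fromℕ< i<k)
      ... | yes _   | no  _   = 0<k
      ... | no  _   | yes _   = 0<k
      ... | no  _   | no  _   = 0<k

      ρ-inj : ∀ t {r i j} → r < a + c → i < k → j < k → ρ t r i ≡ ρ t r j → i ≡ j
      ρ-inj t {r} {i} {j} r<e i<k j<k e with r <? a + c | i <? k | j <? k
      ... | no r≮e  | _       | _       = contradiction r<e r≮e
      ... | yes _   | no i≮k  | _       = contradiction i<k i≮k
      ... | yes _   | yes _   | no j≮k  = contradiction j<k j≮k
      ... | yes r<e | yes i<k | yes j<k = trans (sym (Finₚ.toℕ-fromℕ< i<k))
        (trans (cong toℕ (⟨$⟩ʳ-injective (perm t (fromℕ< r<e)) (Finₚ.toℕ-injective e))) (Finₚ.toℕ-fromℕ< j<k))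

      module F t = Fill (ρ t) (ρ<k t) (ρ-inj t)

      filling-injective : ∀ t t′ → (∀ i → F.filling t ⟨$⟩ʳ i ≡ F.filling t′ ⟨$⟩ʳ i) → t ≡ t′
      filling-injective t t′ e = trans (sym (Finₚ.funToFin-finToFin {a + c} t))
        (trans (funToFin-cong λ r → lookup-unique (permutations-unique k) _ _ (same r))
          (Finₚ.funToFin-finToFin {a + c} t′))
        where
          funToFin-cong : ∀ {m n} {f g : Fin m → Fin n} → (∀ i → f i ≡ g i) → Fin.funToFin f ≡ Fin.funToFin g
          funToFin-cong {zero}  e = refl
          funToFin-cong {suc m} e = cong₂ Fin.combine (e zero) (funToFin-cong (e ∘ suc))
          same : ∀ r i → perm t r ⟨$⟩ʳ i ≡ perm t′ r ⟨$⟩ʳ i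
          same r i = Finₚ.toℕ-injective (trans (sym (ρ≡ t r i)) (trans (+-cancelˡ-≡ (offset (toℕ r)) _ _
            (trans (sym (at-off t)) (trans words (at-off t′)))) (ρ≡ t′ r i)))
            where
              i<k = Finₚ.toℕ<n i
              r<e = Finₚ.toℕ<n r
              p = toℕ i * M + place (offRank (toℕ r))
              words : at (word₀ (F.filling t)) p ≡ at (word₀ (F.filling t′)) p
              words = cong (λ w → at w p) (Listₚ.tabulate-cong (cong toℕ ∘ e))
              at-off : ∀ t → at (word₀ (F.filling t)) p ≡ offset (toℕ r) + ρ t (toℕ r) (toℕ i)
              at-off t = trans (F.at-filling t (position≤N i<k (place≤M (offRank≤M r<e))))
                (trans (F.fill-place t (F.offValid t i<k r<e))
                  (value-off (ρ t) (ρ<k t) (ρ-inj t) (zone (offRank (toℕ r)))))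

    clusters-lower : length (permutations k) ^ (a + c) ≤ clusters (suc N) k
    clusters-lower = subst (length (permutations k) ^ (a + c) ≤_) (sym (clusters-maximal k))
      (count-≥ (λ σ → good? k (word₀ σ)) F.filling
        (λ σ≈τ → subst (Good k) (Listₚ.tabulate-cong (cong toℕ ∘ σ≈τ))) F.filling-good filling-injective)

-- Factorials against powers.

length-product : ∀ {C : Set} (g : A → B → C) xs ys → length (cartesianProductWith g xs ys) ≡ length xs * length ys
length-product g []       ys = refl
length-product g (x ∷ xs) ys = trans (Listₚ.length-++ (map (g x) ys))
  (cong₂ _+_ (Listₚ.length-map (g x) ys) (length-product g xs ys))

#permutations : ℕ → ℕ
#permutations n = length (permutations n)

#permutations-suc : ∀ n → #permutations (suc n) ≡ suc n * #permutations n
#permutations-suc n = trans (length-product (insert zero) (allFin (suc n)) (permutations n))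
  (cong (_* #permutations n) (Listₚ.length-tabulate {n = suc n} id))

#permutations-+ : ∀ j i → j ^ i * #permutations j ≤ #permutations (i + j)
#permutations-+ j zero    = ≤-reflexive (+-identityʳ _)
#permutations-+ j (suc i) = begin
  j * j ^ i * #permutations j       ≡⟨ *-assoc j (j ^ i) _ ⟩
  j * (j ^ i * #permutations j)     ≤⟨ *-mono-≤ (≤-trans (m≤n+m j i) (n≤1+n _)) (#permutations-+ j i) ⟩
  suc (i + j) * #permutations (i + j) ≡⟨ sym (#permutations-suc (i + j)) ⟩
  #permutations (suc i + j) ∎
  where open ≤-Reasoning

*-interchange : ∀ a b c d → (a * b) * (c * d) ≡ (a * c) * (b * d)
*-interchange = interchange′
  where open import Algebra.Properties.CommutativeSemigroup *-commutativeSemigroup using () renaming (interchange to interchange′)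

^-distribʳ-* : ∀ n x y → (x * y) ^ n ≡ x ^ n * y ^ n
^-distribʳ-* zero    x y = refl
^-distribʳ-* (suc n) x y = trans (cong (x * y *_) (^-distribʳ-* n x y)) (*-interchange x y (x ^ n) (y ^ n))

^-swap : ∀ x m n → (x ^ m) ^ n ≡ (x ^ n) ^ m
^-swap x m n = trans (^-*-assoc x m n) (trans (cong (x ^_) (*-comm m n)) (sym (^-*-assoc x n m)))

-- Doubling: with k = 2j, (2j)^(2j) = 4^j (j^j)^2; one factor j^j is at most 4^j j! by induction,
-- and the other gives j^j j! ≤ (2j)!.
#permutations-lower : ∀ s → let k = 2 ^ s in k ^ k ≤ 4 ^ k * #permutations k
#permutations-lower zero    = s≤s z≤n
#permutations-lower (suc s) = subst (λ K → K ^ K ≤ 4 ^ K * #permutations K) (cong (j +_) (sym (+-identityʳ j))) (begin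
  (j + j) ^ (j + j)           ≡⟨ ^-distribˡ-+-* (j + j) j j ⟩
  (j + j) ^ j * (j + j) ^ j   ≡⟨ cong (λ x → x * x) (trans (cong (_^ j) (cong (j +_) (sym (+-identityʳ j)))) (^-distribʳ-* j 2 j)) ⟩
  (2 ^ j * j ^ j) * (2 ^ j * j ^ j) ≡⟨ *-interchange (2 ^ j) (j ^ j) (2 ^ j) (j ^ j) ⟩
  (2 ^ j * 2 ^ j) * (j ^ j * j ^ j) ≡⟨ cong (_* (j ^ j * j ^ j)) (sym (^-distribʳ-* j 2 2)) ⟩
  4 ^ j * (j ^ j * j ^ j) ≤⟨ *-monoʳ-≤ (4 ^ j) (*-monoʳ-≤ (j ^ j) (#permutations-lower s)) ⟩
  4 ^ j * (j ^ j * (4 ^ j * #permutations j)) ≡⟨ cong (4 ^ j *_) (x∙yz≈y∙xz (j ^ j) (4 ^ j) _) ⟩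
  4 ^ j * (4 ^ j * (j ^ j * #permutations j)) ≡⟨ sym (*-assoc (4 ^ j) (4 ^ j) _) ⟩
  4 ^ j * 4 ^ j * (j ^ j * #permutations j)   ≡⟨ cong (_* (j ^ j * #permutations j)) (sym (^-distribˡ-+-* 4 j j)) ⟩
  4 ^ (j + j) * (j ^ j * #permutations j) ≤⟨ *-monoʳ-≤ (4 ^ (j + j)) (#permutations-+ j j) ⟩
  4 ^ (j + j) * #permutations (j + j) ∎)
  where
    open ≤-Reasoning
    open import Algebra.Properties.CommutativeSemigroup *-commutativeSemigroup using (x∙yz≈y∙xz)
    j = 2 ^ s

n<2^n : ∀ n → n < 2 ^ n
n<2^n zero    = s≤s z≤n
n<2^n (suc n) = ≤-trans (+-mono-≤ (m^n>0 2 n) (n<2^n n)) (≤-reflexive (cong (2 ^ n +_) (sym (+-identityʳ (2 ^ n)))))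

^-cancelˡ-≤ : ∀ n .{{_ : NonZero n}} {x y} → x ^ n ≤ y ^ n → x ≤ y
^-cancelˡ-≤ n le = ≮⇒≥ λ y<x → <⇒≱ (^-monoˡ-< n y<x) le

-- Combining `k ^ k ≤ 4 ^ k * #permutations k` with the bound, taking k-th roots and using kM + 1 ≤
-- 2kM gives `k ^ e ≤ C * k ^ e′`. If `e′ < e`, then `k ≤ C`, against `k = 2 ^ C`.
growth : ∀ {M e e′} → 0 < M → (∀ k → 0 < k → #permutations k ^ e ≤ (suc (k * M) ^ k) ^ e′) → e ≤ e′
growth {M} {e} {e′} 0<M bounds = ≮⇒≥ λ e′<e → <⇒≱ (n<2^n C) (small e′<e)
  where
    C = 4 ^ e * (M + M) ^ e′
    k = 2 ^ C
    0<k : 0 < k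
    0<k = m^n>0 2 C
    instance
      k≢0 : NonZero k
      k≢0 = >-nonZero 0<k
    length≤ : suc (k * M) ≤ k * (M + M)
    length≤ = ≤-trans (+-monoˡ-≤ (k * M) (*-mono-≤ 0<k 0<M)) (≤-reflexive (sym (*-distribˡ-+ k M M)))
    open ≤-Reasoning
    open import Algebra.Properties.CommutativeSemigroup *-commutativeSemigroup using (x∙yz≈xz∙y)
    powers : (k ^ e) ^ k ≤ (4 ^ e * suc (k * M) ^ e′) ^ k
    powers = begin
      (k ^ e) ^ k ≡⟨ ^-swap k e k ⟩
      (k ^ k) ^ e ≤⟨ ^-monoˡ-≤ e (#permutations-lower C) ⟩
      (4 ^ k * #permutations k) ^ e ≡⟨ ^-distribʳ-* e (4 ^ k) (#permutations k) ⟩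
      (4 ^ k) ^ e * #permutations k ^ e ≤⟨ *-monoʳ-≤ ((4 ^ k) ^ e) (bounds k 0<k) ⟩
      (4 ^ k) ^ e * (suc (k * M) ^ k) ^ e′ ≡⟨ cong₂ _*_ (^-swap 4 k e) (^-swap (suc (k * M)) k e′) ⟩
      (4 ^ e) ^ k * (suc (k * M) ^ e′) ^ k ≡⟨ sym (^-distribʳ-* k (4 ^ e) (suc (k * M) ^ e′)) ⟩
      (4 ^ e * suc (k * M) ^ e′) ^ k ∎
    small : e′ < e → k ≤ C
    small e′<e = *-cancelʳ-≤ k C (k ^ e′) {{>-nonZero (m^n>0 k e′)}} (begin
      k * k ^ e′ ≤⟨ ^-monoʳ-≤ k e′<e ⟩
      k ^ e ≤⟨ ^-cancelˡ-≤ k powers ⟩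
      4 ^ e * suc (k * M) ^ e′ ≤⟨ *-monoʳ-≤ (4 ^ e) (^-monoˡ-≤ e′ length≤) ⟩
      4 ^ e * (k * (M + M)) ^ e′ ≡⟨ cong (4 ^ e *_) (^-distribʳ-* e′ k (M + M)) ⟩
      4 ^ e * (k ^ e′ * (M + M) ^ e′) ≡⟨ x∙yz≈xz∙y (4 ^ e) (k ^ e′) _ ⟩
      C * k ^ e′ ∎)

-- Comparing the two patterns.

open import Data.Integer.Base using (+_; _-_)

module Shape {m} (π : Permutation′ (suc (suc m))) (π₁<πₘ : first π < last π) where
  private
    M = suc m
    end = π ⟨$⟩ʳ Fin.fromℕ M

  -- These are the parameters `a`, `d`, `c` of `Blocks`; `below + above` is the number of ranks off
  -- the chain.
  below gap above : ℕ
  below = toℕ (π ⟨$⟩ʳ zero)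
  gap   = toℕ end ∸ below
  above = M ∸ toℕ end

  below+gap : below + gap ≡ toℕ end
  below+gap = m+[n∸m]≡n (<⇒≤ (s<s⁻¹ π₁<πₘ))

  M≡ : M ≡ below + (gap + above)
  M≡ = sym (trans (sym (+-assoc below gap above)) (trans (cong (_+ above) below+gap) (m+[n∸m]≡n (s≤s⁻¹ (Finₚ.toℕ<n end)))))

  difference : + last π - + first π ≡ + gap
  difference = trans (ℤₚ.m-n≡m⊖n (last π) (first π)) (ℤₚ.⊖-≥ (<⇒≤ π₁<πₘ))

  open Blocks π below gap above (at-word₀ π zero)
    (trans (cong (at (word₀ π)) (sym (Finₚ.toℕ-fromℕ M))) (trans (at-word₀ π (Fin.fromℕ M)) (sym below+gap)))
    M≡ (m<n⇒0<n∸m (s<s⁻¹ π₁<πₘ)) public using (clusters-upper; clusters-lower)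

module _ {m} (π τ : Permutation′ (suc (suc m))) (p : first π < last π) (t : first τ < last τ)
  (π~τ : StronglyCWilfEquivalent π τ) where
  private
    module P = Shape π p
    module T = Shape τ t

  off-chain-≤ : P.below + P.above ≤ T.below + T.above
  off-chain-≤ = growth {suc m} (s≤s z≤n) λ k 0<k → ≤-trans (P.clusters-lower k 0<k)
    (≤-trans (≤-reflexive (clusters-equal π τ π~τ (suc (k * suc m)) k)) (T.clusters-upper k))

theorem1p9 : ∀ (m : ℕ) (π τ : Permutation′ (suc m)) →
    StandardForm π → StandardForm τ →
    StronglyCWilfEquivalent π τ →
    + last π - + first π ≡ + last τ - + first τ
theorem1p9 zero    π τ (p , _) _       _   = contradiction p (<-irrefl refl)
theorem1p9 (suc m) π τ (p , _) (t , _) π~τ = trans P.difference (trans (cong +_ d≡) (sym T.difference))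
  where
    module P = Shape π p
    module T = Shape τ t
    regroup : ∀ a d c → a + (d + c) ≡ d + (a + c)
    regroup a d c = trans (sym (+-assoc a d c)) (trans (cong (_+ c) (+-comm a d)) (+-assoc d a c))
    e≡ : P.below + P.above ≡ T.below + T.above
    e≡ = ≤-antisym (off-chain-≤ π τ p t π~τ) (off-chain-≤ τ π t p λ n k → sym (π~τ n k))
    d≡ : P.gap ≡ T.gap
    -- For both patterns the gap and the number of off-chain ranks add up to the same `suc m`.
    d≡ = +-cancelʳ-≡ (P.below + P.above) P.gap T.gap (trans (sym (regroup P.below P.gap P.above)) (trans (sym P.M≡)
      (trans T.M≡ (trans (regroup T.below T.gap T.above) (cong₂ _+_ {T.gap} refl (sym e≡))))))
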